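{- Let $T$ be a tree with spread $k$ and diameter $d$. Let $T'$ be the $s$-subdivision of $T$ for some positive integer $s\ge 72d^2/k^3$. Then $(T')^3$ is stackable.
   Context: The spread of a tree is the minimum distance between two distinct leaves. The $s$-subdivision of a graph is obtained by replacing every edge by a path of length $s$. $(T')^3$ is the Cartesian cube $T'\,\square\, T'\,\square\, T'$, where $G\,\square\, H$ has vertex set $V(G)\times V(H)$ and $(v,w)\sim(v',w')$ iff ($v=v'$ and $ww'\in E(H)$) or ($vv'\in E(G)$ and $w=w'$). Cup stacking on a finite connected graph: initially one cup on every vertex; a move takes all $r\ge1$ cups from a vertex $x$ onto a vertex $y\neq x$ that already carries at least one cup and satisfies $d(x,y)=r$ (shortest-path distance). The graph is stackable if for every vertex $t$ some sequence of moves ends with all cups on $t$. -}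

module Defs where

open import Data.Nat using (ℕ; zero; suc; _+_; _∸_; _≤_; _<_; _<?_)
open import Data.Fin using (Fin; fromℕ<)
open import Data.Product using (Σ; ∃; _×_; _,_; proj₁; proj₂)
open import Data.Sum using (_⊎_)
open import Data.Unit using (⊤)
open import Data.List using (List; []; _∷_; _++_; [_]; length)
open import Data.List.Relation.Unary.Unique.Propositional using (Unique)
open import Relation.Nullary using (¬_; yes; no)
open import Relation.Binary.PropositionalEquality using (_≡_; _≢_)
open import Relation.Binary.Construct.Closure.ReflexiveTransitive using (Star)

-- General (possibly infinite-typed) graphs given by a vertex type and an
-- adjacency relation.  All graphs we build are finite and simple.

record Graph : Set₁ where
  field
    V   : Set
    Adj : V → V → Set
open Graph public

module _ (G : Graph) where

  data Walk : V G → V G → ℕ → Set where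
    here : ∀ {x} → Walk x x 0
    step : ∀ {x y z l} → Adj G x y → Walk y z l → Walk x z (suc l)

  Dist : V G → V G → ℕ → Set
  Dist x y r = Walk x y r × (∀ l → Walk x y l → r ≤ l)

  Connected : Set
  Connected = ∀ x y → ∃ λ l → Walk x y l

  Chain : List (V G) → Set
  Chain [] = ⊤
  Chain (x ∷ []) = ⊤
  Chain (x ∷ y ∷ r) = Adj G x y × Chain (y ∷ r)

  HasCycle : Set
  HasCycle = Σ (V G) λ x → Σ (List (V G)) λ vs →
    2 ≤ length vs × Unique (x ∷ vs) × Chain (x ∷ vs ++ [ x ])

  IsTree : Set
  IsTree = Connected × ¬ HasCycle

  IsLeaf : V G → Set
  IsLeaf x = Σ (V G) λ y → Adj G x y × (∀ z → Adj G x z → z ≡ y)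

  HasSpread : ℕ → Set
  HasSpread k =
    (Σ (V G) λ x → Σ (V G) λ y → IsLeaf x × IsLeaf y × x ≢ y × Dist x y k)
    × (∀ x y r → IsLeaf x → IsLeaf y → x ≢ y → Dist x y r → k ≤ r)

  HasDiameter : ℕ → Set
  HasDiameter d =
    (Σ (V G) λ x → Σ (V G) λ y → Dist x y d)
    × (∀ x y r → Dist x y r → r ≤ d)

  -- Cup stacking.  A configuration assigns a number of cups to each vertex.

  Config : Set
  Config = V G → ℕ

  Move : Config → Config → Set
  Move c c' = Σ (V G) λ x → Σ (V G) λ y → Σ ℕ λ r →
    1 ≤ r × c x ≡ r × y ≢ x × 1 ≤ c y × Dist x y r ×
    c' x ≡ 0 × c' y ≡ c y + r × (∀ z → z ≢ x → z ≢ y → c' z ≡ c z)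

  initial : Config
  initial _ = 1

  Stackable : Set
  Stackable = ∀ t → Σ Config λ c → Star Move initial c × (∀ z → z ≢ t → c z ≡ 0)

_□_ : Graph → Graph → Graph
G □ H = record
  { V   = V G × V H
  ; Adj = λ p q → (proj₁ p ≡ proj₁ q × Adj H (proj₂ p) (proj₂ q))
                ⊎ (Adj G (proj₁ p) (proj₁ q) × proj₂ p ≡ proj₂ q) }

cube : Graph → Graph
cube G = G □ (G □ G)

EdgeGraph : ∀ {n m} → (Fin m → Fin n × Fin n) → Graph
EdgeGraph {n} {m} ends = record
  { V   = Fin n
  ; Adj = λ x y → Σ (Fin m) λ e → (ends e ≡ (x , y)) ⊎ (ends e ≡ (y , x)) }

SimpleEdges : ∀ {n m} → (Fin m → Fin n × Fin n) → Set
SimpleEdges {n} {m} ends =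
  (∀ e → proj₁ (ends e) ≢ proj₂ (ends e))
  × (∀ e e' → (ends e ≡ ends e') ⊎ (ends e ≡ (proj₂ (ends e') , proj₁ (ends e'))) → e ≡ e')

-- s-subdivision: edge e = (a , b) becomes the path
--   a = pos e 0, pos e 1, …, pos e s = b
-- whose internal vertices are mid e i, i : Fin (s ∸ 1) (mid e i sits at position i+1).

data SubV (n m s : ℕ) : Set where
  orig : Fin n → SubV n m s
  mid  : Fin m → Fin (s ∸ 1) → SubV n m s

module _ {n m : ℕ} (ends : Fin m → Fin n × Fin n) (s : ℕ) where

  pos : Fin m → ℕ → SubV n m s
  pos e zero = orig (proj₁ (ends e))
  pos e (suc j) with j <? s ∸ 1
  ... | yes p = mid e (fromℕ< p)
  ... | no _  = orig (proj₂ (ends e))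

  Subdivision : Graph
  Subdivision = record
    { V   = SubV n m s
    ; Adj = λ u w → Σ (Fin m) λ e → Σ ℕ λ j → j < s ×
              ((u ≡ pos e j × w ≡ pos e (suc j)) ⊎ (w ≡ pos e j × u ≡ pos e (suc j))) }

{-# OPTIONS --safe #-}

-- Every path v₀ v₁ … in a graph stacks on v₀: if the far end w is at distance δ from v₀, stack the
-- last δ vertices on w (by induction) and move them to v₀; then continue with the shorter path.
-- Hence a path avoiding t can be cleared if it splits into segments I containing a vertex at
-- distance |I| from t.  The distances to t along a path change by exactly 1 at each step in a
-- bipartite graph, and then such a splitting exists as soon as the path has at least about M²
-- vertices, M bounding the distances: the set of positions reachable by k segments contains an
-- interval that grows by one with each k until consecutive intervals overlap.  Finally T′ is
-- partitioned into paths with at least sk/2 vertices, by letting every vertex of the rooted tree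
-- continue the path towards its nearest leaf below; products of three such paths have Hamiltonian
-- paths with at least (sk/2)³ ≥ (3sd)² vertices.

module Submission where

open import Defs
open import Data.Bool using (Bool; not; false; _xor_)
open import Data.Bool.Properties using (not-¬; not-involutive; not-distribˡ-xor; not-distribʳ-xor)
open import Data.Empty using (⊥; ⊥-elim)
open import Data.Fin using (Fin; toℕ; fromℕ<)
open import Data.Fin.Properties using (_≟_; any?; toℕ<n; fromℕ<-toℕ; toℕ-fromℕ<)
open import Data.List using (List; []; _∷_; _++_; [_]; length; reverse; take; drop; map; concat; filter; allFin; applyUpTo; cartesianProductWith)
open import Data.List.Extrema.Nat using (argmin; argmin-sel; f[argmin]≤f[⊤]; f[argmin]≤f[xs])
open import Data.List.Membership.Propositional using (_∈_; _∉_; find; lose)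
open import Data.List.Membership.Propositional.Properties using (∈-++⁺ˡ; ∈-++⁺ʳ; ∈-++⁻; ∈-∃++; ∈-map⁺; ∈-map⁻; ∈-filter⁺; ∈-filter⁻; ∈-allFin; ∈-concat⁺′; ∈-concat⁻′; ∈-applyUpTo⁺; ∈-applyUpTo⁻; ∈-cartesianProductWith⁺)
import Data.List.Membership.DecPropositional as DecMembership
open import Data.List.Properties using (≡-dec; ∷-injectiveʳ; ++-assoc; ++-identityʳ; map-++; unfold-reverse; reverse-involutive; take++drop≡id; take-all; length-++; length-map; length-reverse; length-take; length-drop; length-applyUpTo; applyUpTo-∷ʳ)
open import Data.List.Relation.Binary.Disjoint.Propositional using (Disjoint)
open import Data.List.Relation.Binary.Permutation.Propositional using (_↭_; ↭-sym; prep; swap; refl; trans)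
open import Data.List.Relation.Binary.Permutation.Propositional.Properties using (∈-resp-↭; All-resp-↭; ↭-length; ↭-reverse; ++⁺ʳ; shift)
open import Data.List.Relation.Unary.All as All using (All; []; _∷_)
import Data.List.Relation.Unary.All.Properties as All
open import Data.List.Relation.Unary.AllPairs as AllPairs using (AllPairs; []; _∷_)
import Data.List.Relation.Unary.AllPairs.Properties as AllPairs
open import Data.List.Relation.Unary.Any as Any using (Any; here; there)
import Data.List.Relation.Unary.Any.Properties as Any
open import Data.List.Relation.Unary.Linked as Linked using (Linked; []; [-]; _∷_)
import Data.List.Relation.Unary.Linked.Properties as Linked
open import Data.List.Relation.Unary.Unique.Propositional using (Unique)
import Data.List.Relation.Unary.Unique.Propositional.Properties as Unique
open import Data.Nat hiding (_≟_)
open import Data.Nat.Properties hiding (_≟_)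
open import Data.Nat.Solver using (module +-*-Solver)
open import Data.Product using (Σ; ∃; _×_; _,_; proj₁; proj₂)
import Data.Product.Properties as Product
open import Data.Sum using (_⊎_; inj₁; inj₂)
open import Data.Unit using (tt)
open import Function using (_∘_)
open import Relation.Binary.Construct.Closure.ReflexiveTransitive as Star using (Star; ε; _◅_; _◅◅_)
open import Relation.Binary.Definitions using (DecidableEquality; Symmetric) renaming (Decidable to Decidable₂)
open import Relation.Binary.PropositionalEquality as ≡ using (_≡_; _≢_; refl; sym; cong; cong₂; subst; subst₂; ≢-sym)
open import Relation.Nullary using (¬_; Dec; yes; no)
open import Relation.Nullary.Decidable using (map′; _×-dec_; _⊎-dec_; ¬?)
open import Relation.Unary using (Decidable)

-- Cutting a sequence

least : {P : ℕ → Set} → Decidable P → ∀ m → P m →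
        ∃ λ n → n ≤ m × P n × (∀ k → P k → n ≤ k)
least P? m pm with P? 0
... | yes p0 = 0 , z≤n , p0 , λ _ _ → z≤n
least P? zero pm | no ¬p0 = ⊥-elim (¬p0 pm)
least P? (suc m) pm | no ¬p0 with least (λ i → P? (suc i)) m pm
... | n , n≤m , pn , min = suc n , s≤s n≤m , pn ,
      λ { zero p → ⊥-elim (¬p0 p) ; (suc k) p → s≤s (min k p) }

infix 4 _↕_
_↕_ : ℕ → ℕ → Set
a ↕ b = (b ≡ suc a) ⊎ (a ≡ suc b)

ivt↑ : (g : ℕ → ℕ) → (∀ i → g i ↕ g (suc i)) → ∀ n w → g 0 ≤ n → n ≤ g w →
       ∃ λ l → l ≤ w × g l ≡ n
ivt↑ g alt n w lo hi with m≤n⇒m<n∨m≡n lo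
... | inj₂ e = 0 , z≤n , e
ivt↑ g alt n zero lo hi | inj₁ g0<n = ⊥-elim (<-irrefl refl (<-≤-trans g0<n hi))
ivt↑ g alt n (suc w) lo hi | inj₁ g0<n
  with ivt↑ (λ i → g (suc i)) (λ i → alt (suc i)) n w lo′ hi
  where lo′ : g 1 ≤ n
        lo′ with alt 0
        ... | inj₁ e = subst (_≤ n) (sym e) g0<n
        ... | inj₂ e = ≤-trans (n≤1+n _) (subst (_≤ n) e lo)
... | l , l≤w , e = suc l , s≤s l≤w , e

ivt↓ : (g : ℕ → ℕ) → (∀ i → g i ↕ g (suc i)) → ∀ n w → n ≤ g 0 → g w ≤ n →
       ∃ λ l → l ≤ w × g l ≡ n
ivt↓ g alt n w hi lo with m≤n⇒m<n∨m≡n hi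
... | inj₂ e = 0 , z≤n , sym e
ivt↓ g alt n zero hi lo | inj₁ n<g0 = ⊥-elim (<-irrefl refl (<-≤-trans n<g0 lo))
ivt↓ g alt n (suc w) hi lo | inj₁ n<g0
  with ivt↓ (λ i → g (suc i)) (λ i → alt (suc i)) n w hi′ lo
  where hi′ : n ≤ g 1
        hi′ with alt 0
        ... | inj₁ e = ≤-trans (<⇒≤ n<g0) (subst (g 0 ≤_) (sym e) (n≤1+n _))
        ... | inj₂ e = s≤s⁻¹ (subst (n <_) e n<g0)
... | l , l≤w , e = suc l , s≤s l≤w , e

module Cuts (f : ℕ → ℕ) (M : ℕ) (positive : ∀ i → 1 ≤ f i) (bounded : ∀ i → f i ≤ suc M)
            (alt : ∀ i → f i ↕ f (suc i)) where

  -- With f the distance to t, `Good i n` marks the segment of length n starting at i as clearable;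
  -- `Lo` and `Hi` are its two one-sided halves.
  Good Lo Hi : ℕ → ℕ → Set
  Good i n = ∃ λ l → l < n × f (i + l) ≡ n
  Lo   i n = ∃ λ l → l < n × f (i + l) ≤ n
  Hi   i n = ∃ λ l → l < n × n ≤ f (i + l)

  data Cut : ℕ → Set where
    start : Cut 0
    next  : ∀ {i n} → Cut i → Good i n → Cut (i + n)

  alt+ : ∀ i l → f (i + l) ↕ f (i + suc l)
  alt+ i l rewrite +-suc i l = alt (i + l)

  lo? : ∀ i → Decidable (Lo i)
  lo? i n = anyUpTo? (λ l → f (i + l) ≤? n) n

  hi? : ∀ i → Decidable (Hi i)
  hi? i n = anyUpTo? (λ l → n ≤? f (i + l)) n

  -- Discrete intermediate values: from the first position of the segment, walk to the `Hi` witness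
  -- if the value there is too small, to the `Lo` witness otherwise.
  good : ∀ {i n} → Lo i n → Hi i n → Good i n
  good {i} {n} (l , l<n , lo) (h , h<n , hi) with ≤-total (f (i + 0)) n
  ... | inj₁ le = let j , j≤h , e = ivt↑ (λ l → f (i + l)) (alt+ i) n h le hi
                  in j , ≤-<-trans j≤h h<n , e
  ... | inj₂ ge = let j , j≤l , e = ivt↓ (λ l → f (i + l)) (alt+ i) n l ge lo
                  in j , ≤-<-trans j≤l l<n , e

  lo-mono : ∀ {i n n′} → n ≤ n′ → Lo i n → Lo i n′
  lo-mono le (l , l<n , p) = l , <-≤-trans l<n le , ≤-trans p le

  -- Shortening the segment can lose only a witness in its last position, and then the position
  -- before it has a value at most one smaller.
  hi-pred : ∀ {i n} → 1 ≤ n → Hi i (suc n) → Hi i n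
  hi-pred {i} {suc n} _ (l , l<2+n , p) with m≤n⇒m<n∨m≡n (s≤s⁻¹ l<2+n)
  ... | inj₁ l<1+n = l , l<1+n , ≤-trans (n≤1+n _) p
  ... | inj₂ refl = n , ≤-refl , drop1 (alt+ i n)
    where drop1 : f (i + n) ↕ f (i + suc n) → suc n ≤ f (i + n)
          drop1 (inj₁ e) = s≤s⁻¹ (subst (suc (suc n) ≤_) e p)
          drop1 (inj₂ e) = subst (suc n ≤_) (sym e) (≤-trans (≤-trans (n≤1+n _) p) (n≤1+n _))

  hi-mono : ∀ {i n} k → 1 ≤ n → Hi i (k + n) → Hi i n
  hi-mono zero 1≤n h = h
  hi-mono {n = n} (suc k) 1≤n h = hi-mono k 1≤n (hi-pred (≤-trans 1≤n (m≤n+m n k)) h)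

  Cuts-on : ℕ → ℕ → Set
  Cuts-on a b = ∀ i → a ≤ i → i ≤ b → Cut i

  -- Walk i down from b to a: as long as Lo i (j ∸ i) fails, f i itself witnesses Hi one
  -- step earlier, so the first success satisfies both bounds.
  advance : ∀ {a D n m} → Cuts-on a (a + D) → Lo a n → Hi (a + D) m →
            Cuts-on (a + n) (a + D + m)
  advance {a} {D} {n} {m} cuts lo hi j lb ub with ≤-total j (a + D)
  ... | inj₁ j≤b = cuts j (≤-trans (m≤m+n a n) lb) j≤b
  ... | inj₂ b≤j with m≤n⇒m<n∨m≡n b≤j
  ...   | inj₂ refl = cuts j (m≤m+n a D) ≤-refl
  ...   | inj₁ b<j = subst Cut eq (go D (j ∸ (a + D)) ≤-refl (m<n⇒0<n∸m b<j)
                       (subst (a + n ≤_) (sym eq) lb) (hi-mono (m ∸ (j ∸ (a + D))) (m<n⇒0<n∸m b<j)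
                         (subst (Hi (a + D)) (sym (m∸n+n≡m (m≤n+o⇒m∸n≤o j (a + D) ub))) hi)))
    where
    eq : a + D + (j ∸ (a + D)) ≡ j
    eq = m+[n∸m]≡n b≤j
    go : ∀ w r → w ≤ D → 1 ≤ r → a + n ≤ a + w + r → Hi (a + w) r → Cut (a + w + r)
    go w r w≤D 1≤r le h with lo? (a + w) r
    ... | yes l = next (cuts (a + w) (m≤m+n a w) (+-monoʳ-≤ a w≤D)) (good l h)
    -- At `a` the remaining length is at least n, so `Lo a n` carries over and the descent must have
    -- succeeded.
    go zero r w≤D 1≤r le h | no ¬l =
      ⊥-elim (¬l (subst (λ z → Lo z r) (sym (+-identityʳ a))
        (lo-mono (+-cancelˡ-≤ a n r (subst (λ z → a + n ≤ z + r) (+-identityʳ a) le)) lo)))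
    go (suc w) r w≤D 1≤r le h | no ¬l =
      subst Cut e (go w (suc r) (<⇒≤ w≤D) (s≤s z≤n) (subst (a + n ≤_) (sym e) le) (1 , s≤s 1≤r , big))
      where
      e : a + w + suc r ≡ a + suc w + r
      e = ≡.trans (+-suc (a + w) r) (cong (_+ r) (sym (+-suc a w)))
      big : suc r ≤ f (a + w + 1)
      big = ≰⇒> λ p → ¬l (0 , 1≤r , subst (λ z → f z ≤ r)
              (≡.trans (+-comm (a + w) 1) (≡.trans (sym (+-suc a w)) (sym (+-identityʳ _)))) p)

  Cuts-from : ℕ → Set
  Cuts-from a = ∀ j → a ≤ j → Cut j

  -- As f is positive, `Hi` holds everywhere for length 1, so `advance` pushes the right end by one
  -- at a time. It covers only positions from a + n on, and n ≤ D + 1 puts the first new position a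
  -- + D + 1 among them.
  no-gap : ∀ {a D n} → Cuts-on a (a + D) → Lo a n → n ≤ suc D → Cuts-from a
  no-gap {a} {D} {n} cuts lo n≤ j a≤j = extend j j a≤j (m≤n+m j (a + D))
    where
    extend : ∀ w → Cuts-on a (a + D + w)
    extend zero i p q = cuts i p (subst (i ≤_) (+-identityʳ _) q)
    extend (suc w) i p q with m≤n⇒m<n∨m≡n q
    ... | inj₁ i< = extend w i p (s≤s⁻¹ (subst (i <_) (+-suc (a + D) w) i<))
    ... | inj₂ refl =
      advance {a} {D + w} {n} {1}
        (λ i p q → extend w i p (subst (i ≤_) (sym (+-assoc a D w)) q)) lo
        (0 , s≤s z≤n , positive _) i
        (subst (a + n ≤_) (≡.trans (sym (+-assoc a (D + w) 1)) e)
          (+-monoʳ-≤ a (≤-trans n≤ (subst (suc D ≤_) (+-comm 1 (D + w)) (s≤s (m≤m+n D w))))))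
        (≤-reflexive (sym e))
      where
      e : a + (D + w) + 1 ≡ a + D + suc w
      e = ≡.trans (cong (_+ 1) (sym (+-assoc a D w))) (≡.trans (+-assoc (a + D) w 1) (cong (a + D +_) (+-comm w 1)))

  module _ (2≤M : 2 ≤ M) where

    -- Neighbouring values differ, so of two consecutive ones at most one equals M + 1.
    lo-M : ∀ a → Lo a M
    lo-M a with f (a + 0) ≤? M | alt+ a 0
    ... | yes p | _ = 0 , ≤-trans (s≤s z≤n) 2≤M , p
    ... | no ¬p | inj₁ e = ⊥-elim (¬p (s≤s⁻¹ (subst (_≤ suc M) e (bounded (a + 1)))))
    ... | no ¬p | inj₂ e = 1 , 2≤M , s≤s⁻¹ (subst (_≤ suc M) e (bounded (a + 0)))

    -- Neighbouring values differ, so two that are at least n are not both n; `lower` is the mirror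
    -- image.
    higher : ∀ i n → n ≤ f (i + 0) → n ≤ f (i + 1) → 1 ≤ n → Hi i (suc n)
    higher i n p q 1≤n with alt+ i 0
    ... | inj₁ e = 1 , s≤s 1≤n , subst (suc n ≤_) (sym e) (s≤s p)
    ... | inj₂ e = 0 , s≤s z≤n , subst (suc n ≤_) (sym e) (s≤s q)

    lower : ∀ i n → f (i + 0) ≤ suc n → f (i + 1) ≤ suc n → 2 ≤ n → Lo i n
    lower i n p q 2≤n with alt+ i 0
    ... | inj₁ e = 0 , ≤-trans (s≤s z≤n) 2≤n , s≤s⁻¹ (subst (_≤ suc n) e q)
    ... | inj₂ e = 1 , 2≤n , s≤s⁻¹ (subst (_≤ suc n) e p)

    Final : Set
    Final = ∃ λ a → a ≤ M * M + 4 × Cuts-from a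

    -- A round raises D by one and moves the left end by at most M, hence the bound M * M + 4. `g`
    -- counts the rounds left: at D = M the length needed for `Lo` is at most M, so no gap remains.
    grow : ∀ g D a → D + g ≡ M → 1 ≤ D → a ≤ D * M + 4 → Cuts-on a (a + D) → Final
    grow g D a D+g 1≤D a≤ cuts with least (lo? a) M (lo-M a)
    ... | n , n≤M , lo , min with n ≤? suc D
    ...   | yes n≤ = a , ≤-trans a≤ (+-monoˡ-≤ 4 (*-monoˡ-≤ M (subst (D ≤_) D+g (m≤m+n D g)))) ,
                     no-gap cuts lo n≤
    grow zero D a D+g 1≤D a≤ cuts | n , n≤M , lo , min | no n≰ =
      ⊥-elim (n≰ (≤-trans n≤M (subst (_≤ suc D) (≡.trans (sym (+-identityʳ D)) D+g) (n≤1+n D))))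
    grow (suc g) D a D+g 1≤D a≤ cuts | suc n , n<M , lo , min | no n≰ = dichotomy
      where
      D<n : D < n
      D<n = s≤s⁻¹ (≰⇒> n≰)
      large : ∀ l → l < n → suc n ≤ f (a + l)
      large l l<n = ≰⇒> λ p → <-irrefl refl (min n (l , l<n , p))
      a≤′ : a + suc n ≤ suc D * M + 4
      a≤′ = ≤-trans (+-mono-≤ a≤ n<M) (≤-reflexive
              (≡.trans (+-comm (D * M + 4) M) (sym (+-assoc M (D * M) 4))))
      at : ∀ l → suc n ≤ f (a + (D + l)) → suc n ≤ f (a + D + l)
      at l = subst (λ z → suc n ≤ f z) (sym (+-assoc a D l))
      at0 : suc n ≤ f (a + D + 0)
      at0 = at 0 (large (D + 0) (subst (_< n) (sym (+-identityʳ D)) D<n))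
      +-right-comm : ∀ x → a + D + x ≡ a + x + D
      +-right-comm x = ≡.trans (+-assoc a D x) (≡.trans (cong (a +_) (+-comm D x)) (sym (+-assoc a x D)))
      dichotomy : Final
      dichotomy with hi? (a + D) (suc (suc n))
      -- The left end moves by n + 1 and the right end by n + 2, so the interval gains one position.
      ... | yes h = grow g (suc D) (a + suc n) (≡.trans (sym (+-suc D g)) D+g) (s≤s z≤n) a≤′
            (λ i p q → advance cuts lo h i p (subst (i ≤_)
               (≡.trans (+-suc (a + suc n) D) (≡.trans (cong suc (sym (+-right-comm (suc n)))) (sym (+-suc (a + D) (suc n))))) q))
      -- Now all values met from a + D on are at most n + 1, while minimality makes the first n
      -- values from `a` at least n + 1. Two consecutive ones of the latter kind at a + D would
      -- force n + 2, so n = D + 1. The interval moves without growing, but at its new left end `Lo`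
      -- holds for length D + 1, which is all that `no-gap` asks.
      ... | no ¬h = a + suc n , ≤-trans a≤′ (+-monoˡ-≤ 4 (*-monoˡ-≤ M (subst (D <_) D+g (m<m+n D (s≤s z≤n))))) ,
            no-gap {a + suc n} {D} {n}
              (λ i p q → advance cuts lo (0 , s≤s z≤n , at0) i p (subst (i ≤_) (sym (+-right-comm (suc n))) q))
              (lower (a + suc n) n (small 2 (s≤s (s≤s (≤-trans (s≤s z≤n) 2≤n))) e2) (small 3 (s≤s (s≤s 2≤n)) e3) 2≤n)
              (≤-reflexive n≡)
        where
        n≡ : n ≡ suc D
        n≡ with m≤n⇒m<n∨m≡n D<n
        ... | inj₂ e = sym e
        ... | inj₁ lt = ⊥-elim (¬h (higher (a + D) (suc n) at0
                (at 1 (large (D + 1) (subst (_< n) (+-comm 1 D) lt))) (s≤s z≤n)))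
        2≤n : 2 ≤ n
        2≤n = subst (2 ≤_) (sym n≡) (s≤s 1≤D)
        e2 : a + D + 2 ≡ a + suc n + 0
        e2 = ≡.trans (+-assoc a D 2) (≡.trans (cong (a +_) (≡.trans (+-comm D 2) (cong suc (sym n≡)))) (sym (+-identityʳ _)))
        e3 : a + D + 3 ≡ a + suc n + 1
        e3 = ≡.trans (+-suc (a + D) 2) (≡.trans (cong suc (≡.trans e2 (+-identityʳ _))) (+-comm 1 (a + suc n)))
        small : ∀ l {x} → l < suc (suc n) → a + D + l ≡ x → f x ≤ suc n
        small l l< refl = ≮⇒≥ λ p → ¬h (l , l< , p)

    pair : ∀ {a} → Cut a → Cut (suc a) → Cuts-on a (a + 1)
    pair {a} c c′ i p q with m≤n⇒m<n∨m≡n p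
    ... | inj₂ refl = c
    ... | inj₁ a<i = subst Cut (≤-antisym a<i (subst (i ≤_) (+-comm a 1) q)) c′

    from-pair : ∀ a → a ≤ M + 4 → Cut a → Cut (suc a) → Final
    from-pair a a≤ c c′ = grow (M ∸ 1) 1 a (m+[n∸m]≡n (≤-trans (s≤s z≤n) 2≤M)) ≤-refl
      (subst (λ z → a ≤ z + 4) (sym (*-identityˡ M)) a≤) (pair c c′)

    -- The sequence 2, 1, 2, 1, …, 2 of odd length cannot be cut, whence the last hypothesis.
    eventually-cut : ¬ (f 1 ≡ 1 × f 3 ≡ 1) → Final
    eventually-cut H with f 0 in e0 | f 1 in e1 | alt 0
    ... | zero | _ | _ = ⊥-elim (<-irrefl refl (subst (1 ≤_) e0 (positive 0)))
    ... | suc zero | _ | _ = 0 , z≤n , no-gap {0} {0} {1} (λ { zero _ _ → start }) (0 , s≤s z≤n , ≤-reflexive e0) ≤-refl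
    ... | suc (suc x) | _ | inj₁ refl = from-pair (2 + x)
          (≤-trans (s≤s⁻¹ (subst (_≤ suc M) e1 (bounded 1))) (m≤m+n M 4))
          (next start (0 , s≤s z≤n , e0)) (next start (1 , s≤s (s≤s z≤n) , e1))
    ... | suc (suc (suc x)) | _ | inj₂ refl = from-pair (2 + x)
          (≤-trans (s≤s⁻¹ (subst (_≤ suc M) e0 (bounded 0))) (m≤m+n M 4))
          (next start (1 , s≤s (s≤s z≤n) , e1)) (next start (0 , s≤s z≤n , e0))
    -- The start 2, 1 offers only the cut at 2; restarting there with values 2, 3 gives the
    -- consecutive cuts 4 and 5. This case alone costs the summand 4, the others beginning at M or
    -- earlier.
    ... | suc (suc zero) | _ | inj₂ refl = from-pair 4 (m≤n+m 4 M)
          (next c2 (0 , s≤s z≤n , f2)) (next c2 (1 , s≤s (s≤s z≤n) , f3))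
      where
      c2 : Cut 2
      c2 = next start (0 , s≤s z≤n , e0)
      f2 : f 2 ≡ 2
      f2 with alt 1
      ... | inj₁ e = ≡.trans e (cong suc e1)
      ... | inj₂ e = ⊥-elim (<-irrefl refl (subst (1 ≤_) (suc-injective (≡.trans (sym e) e1)) (positive 2)))
      f3 : f 3 ≡ 3
      f3 with alt 2
      ... | inj₁ e = ≡.trans e (cong suc f2)
      ... | inj₂ e = ⊥-elim (H (refl , suc-injective (≡.trans (sym e) f2)))

-- Stacking along paths

module _ {A : Set} where

  unique-resp-↭ : ∀ {xs ys : List A} → xs ↭ ys → Unique xs → Unique ys
  unique-resp-↭ refl u = u
  unique-resp-↭ (prep x p) (a ∷ u) = All-resp-↭ p a ∷ unique-resp-↭ p u
  unique-resp-↭ (swap x y p) ((x≢y ∷ a) ∷ b ∷ u) =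
    (≢-sym x≢y ∷ All-resp-↭ p b) ∷ All-resp-↭ p a ∷ unique-resp-↭ p u
  unique-resp-↭ (trans p q) u = unique-resp-↭ q (unique-resp-↭ p u)

  unique-∉ : ∀ {x : A} {xs} → Unique (x ∷ xs) → x ∉ xs
  unique-∉ (a ∷ _) x∈ = All.lookup a x∈ refl

  unique-++⁻ : ∀ (xs : List A) {ys} → Unique (xs ++ ys) → Unique xs × Unique ys × Disjoint xs ys
  unique-++⁻ [] u = [] , u , λ { (() , _) }
  unique-++⁻ (x ∷ xs) (a ∷ u) with unique-++⁻ xs u
  ... | ux , uy , d = All.++⁻ˡ xs a ∷ ux , uy ,
    λ { (here refl , q) → All.lookup (All.++⁻ʳ xs a) q refl ; (there p , q) → d (p , q) }

  split-at : ∀ (xs : List A) l → l < length xs → ∃ λ ys → ∃ λ y → ∃ λ zs → xs ≡ ys ++ y ∷ zs × length ys ≡ l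
  split-at (x ∷ xs) zero l< = [] , x , xs , refl , refl
  split-at (x ∷ xs) (suc l) (s≤s l<) with split-at xs l l<
  ... | ys , y , zs , refl , e = x ∷ ys , y , zs , refl , cong suc e

  module _ {R : A → A → Set} where

    linked-suffix : ∀ xs {ys} → Linked R (xs ++ ys) → Linked R ys
    linked-suffix [] l = l
    linked-suffix (x ∷ xs) l = linked-suffix xs (Linked.tail l)

    linked-prefix : ∀ xs {ys} → Linked R (xs ++ ys) → Linked R xs
    linked-prefix [] l = []
    linked-prefix (x ∷ []) l = [-]
    linked-prefix (x ∷ y ∷ xs) (r ∷ l) = r ∷ linked-prefix (y ∷ xs) l

    linked-glue : ∀ xs {y ys} → Linked R (xs ++ [ y ]) → Linked R (y ∷ ys) → Linked R (xs ++ y ∷ ys)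
    linked-glue [] l l′ = l′
    linked-glue (x ∷ []) (r ∷ _) l′ = r ∷ l′
    linked-glue (x ∷ z ∷ xs) (r ∷ l) l′ = r ∷ linked-glue (z ∷ xs) l l′

    linked-upto : ∀ xs {y ys} → Linked R (xs ++ y ∷ ys) → Linked R (xs ++ [ y ])
    linked-upto xs {y} {ys} l = linked-prefix (xs ++ [ y ]) (subst (Linked R) (sym (++-assoc xs [ y ] ys)) l)

    linked-reverse : Symmetric R → ∀ {xs} → Linked R xs → Linked R (reverse xs)
    linked-reverse s [] = []
    linked-reverse s [-] = [-]
    linked-reverse s {x ∷ y ∷ xs} (r ∷ l) = subst (Linked R) (sym eq)
      (linked-glue (reverse xs) (subst (Linked R) (unfold-reverse y xs) (linked-reverse s l)) (s r ∷ [-]))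
      where
      eq : reverse (x ∷ y ∷ xs) ≡ reverse xs ++ y ∷ [ x ]
      eq = ≡.trans (unfold-reverse x (y ∷ xs))
             (≡.trans (cong (_++ [ x ]) (unfold-reverse y xs)) (++-assoc (reverse xs) [ y ] [ x ]))

linked-walk : ∀ G {w v} xs → Linked (Adj G) (w ∷ xs ++ [ v ]) → Walk G w v (suc (length xs))
linked-walk G [] (r ∷ _) = step r here
linked-walk G (x ∷ xs) (r ∷ l) = step r (linked-walk G xs l)

-- The clause t ∉ xs excludes the four-cycle through t that every product graph contains.
NoSquare : (G : Graph) → List (V G) → Set
NoSquare G xs = ∀ t x y z → t ∉ xs → x ∈ xs → y ∈ xs → z ∈ xs →
  Adj G x y → Adj G y z → x ≢ z → Adj G x t → Adj G z t → ⊥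

record Metric (G : Graph) : Set where
  field
    _≟V_    : DecidableEquality (V G)
    adj-sym : Symmetric (Adj G)
    dist    : V G → V G → ℕ
    isDist  : ∀ x y → Dist G x y (dist x y)

module Stacking (G : Graph) (metric : Metric G) where
  open Metric metric

  dist≢0 : ∀ {x y} → x ≢ y → 1 ≤ dist x y
  dist≢0 {x} {y} x≢y with dist x y | proj₁ (isDist x y)
  ... | zero  | here = ⊥-elim (x≢y refl)
  ... | suc _ | _ = s≤s z≤n

  -- Quantified over every configuration that is still untouched on B, and leaving everything else
  -- fixed, so that stackings of disjoint pieces can be run one after another.
  Stacks : V G → List (V G) → Set
  Stacks v B = ∀ c → 1 ≤ c v → (∀ x → x ∈ B → c x ≡ 1) → ∃ λ c′ →
    Star (Move G) c c′ × c′ v ≡ c v + length B ×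
    (∀ x → x ∈ B → c′ x ≡ 0) × (∀ x → x ≢ v → x ∉ B → c′ x ≡ c x)

  stacks-[] : ∀ {v} → Stacks v []
  stacks-[] c _ _ = c , ε , sym (+-identityʳ _) , (λ _ ()) , λ _ _ _ → refl

  stacks-↭ : ∀ {v B B′} → B ↭ B′ → Stacks v B → Stacks v B′
  stacks-↭ {v} p st c cv ones with st c cv (λ x x∈ → ones x (∈-resp-↭ p x∈))
  ... | c′ , moves , total , zeros , rest =
    c′ , moves , ≡.trans total (cong (c v +_) (↭-length p)) ,
    (λ x x∈ → zeros x (∈-resp-↭ (↭-sym p) x∈)) ,
    λ x x≢v x∉ → rest x x≢v (λ x∈ → x∉ (∈-resp-↭ p x∈))

  stacks-++ : ∀ {v} A {B} → Unique (v ∷ A ++ B) → Stacks v A → Stacks v B → Stacks v (A ++ B)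
  stacks-++ {v} A {B} u@(_ ∷ uAB) stA stB c cv ones with stA c cv (λ x x∈ → ones x (∈-++⁺ˡ x∈))
  ... | c₁ , moves₁ , total₁ , zeros₁ , rest₁
    with stB c₁ (≤-trans cv (subst (c v ≤_) (sym total₁) (m≤m+n _ _)))
           (λ x x∈ → ≡.trans (rest₁ x (λ { refl → unique-∉ u (∈-++⁺ʳ A x∈) })
                        (λ x∈A → proj₂ (proj₂ (unique-++⁻ A uAB)) (x∈A , x∈))) (ones x (∈-++⁺ʳ A x∈)))
  ... | c₂ , moves₂ , total₂ , zeros₂ , rest₂ = c₂ , moves₁ ◅◅ moves₂ ,
      ≡.trans total₂ (≡.trans (cong (_+ length B) total₁)
        (≡.trans (+-assoc (c v) _ _) (cong (c v +_) (sym (length-++ A))))) ,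
      zeros , λ x x≢v x∉ → ≡.trans (rest₂ x x≢v (λ q → x∉ (∈-++⁺ʳ A q))) (rest₁ x x≢v (λ q → x∉ (∈-++⁺ˡ q)))
    where
    zeros : ∀ x → x ∈ A ++ B → c₂ x ≡ 0
    zeros x x∈ with ∈-++⁻ A x∈
    ... | inj₂ x∈B = zeros₂ x x∈B
    ... | inj₁ x∈A = ≡.trans (rest₂ x (λ { refl → unique-∉ u x∈ })
                       (λ x∈B → proj₂ (proj₂ (unique-++⁻ A uAB)) (x∈A , x∈B))) (zeros₁ x x∈A)

  stacks-relay : ∀ {v w B} → Unique (v ∷ w ∷ B) → dist w v ≡ suc (length B) → Stacks w B → Stacks v (w ∷ B)
  stacks-relay {v} {w} {B} u@(_ ∷ uw) δ st c cv ones
    with st c (≤-reflexive (sym (ones w (here refl)))) (λ x x∈ → ones x (there x∈))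
  ... | c₁ , moves , total , zeros , rest =
    c₂ , moves ◅◅ (move ◅ ε) , ≡.trans at-v (cong (_+ suc (length B)) c₁v) , zeros₂ , rest₂
    where
    v≢w : v ≢ w
    v≢w refl = unique-∉ u (here refl)
    c₁v : c₁ v ≡ c v
    c₁v = rest v v≢w (λ v∈ → unique-∉ u (there v∈))
    c₁w : c₁ w ≡ suc (length B)
    c₁w = ≡.trans total (cong (_+ length B) (ones w (here refl)))
    c₂ : Config G
    c₂ x with x ≟V w | x ≟V v
    ... | yes _ | _ = 0
    ... | no _ | yes _ = c₁ v + suc (length B)
    ... | no _ | no _ = c₁ x
    at-w : c₂ w ≡ 0
    at-w with w ≟V w
    ... | yes _ = refl
    ... | no w≢w = ⊥-elim (w≢w refl)
    at-v : c₂ v ≡ c₁ v + suc (length B)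
    at-v with v ≟V w | v ≟V v
    ... | yes e | _ = ⊥-elim (v≢w e)
    ... | no _ | yes _ = refl
    ... | no _ | no v≢v = ⊥-elim (v≢v refl)
    other : ∀ x → x ≢ w → x ≢ v → c₂ x ≡ c₁ x
    other x x≢w x≢v with x ≟V w | x ≟V v
    ... | yes e | _ = ⊥-elim (x≢w e)
    ... | no _ | yes e = ⊥-elim (x≢v e)
    ... | no _ | no _ = refl
    move : Move G c₁ c₂
    move = w , v , suc (length B) , s≤s z≤n , c₁w , v≢w , subst (1 ≤_) (sym c₁v) cv ,
           subst (Dist G w v) δ (isDist w v) , at-w , at-v , other
    zeros₂ : ∀ x → x ∈ w ∷ B → c₂ x ≡ 0
    zeros₂ x (here refl) = at-w
    zeros₂ x (there x∈) = ≡.trans (other x (λ { refl → unique-∉ uw x∈ })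
                            (λ { refl → unique-∉ u (there x∈) })) (zeros x x∈)
    rest₂ : ∀ x → x ≢ v → x ∉ w ∷ B → c₂ x ≡ c x
    rest₂ x x≢v x∉ = ≡.trans (other x (λ { refl → x∉ (here refl) }) x≢v)
                       (rest x (λ { refl → x∉ (here refl) }) (λ x∈ → x∉ (there x∈)))

  -- The list runs towards v, so its head is the far end. The recursion enters `reverse X` and `Y`,
  -- which are not structural sublists; hence the fuel.
  stacks-path-fuel : ∀ n B v → length B ≤ n → Linked (Adj G) (B ++ [ v ]) → Unique (v ∷ B) → Stacks v B
  stacks-path-fuel n [] v _ _ _ = stacks-[]
  stacks-path-fuel (suc n) (w ∷ B) v (s≤s B≤n) linked unique
    with dist w v in δ≡ | dist≢0 {w} {v} (λ { refl → unique-∉ unique (here refl) })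
  ... | suc δ | _ =
    subst (Stacks v) (cong (w ∷_) (take++drop≡id δ B))
      (stacks-↭ (prep w (++⁺ʳ Y (↭-reverse X)))
        (stacks-++ (w ∷ reverse X) unique′
          (stacks-relay (proj₁ (unique-++⁻ (v ∷ w ∷ reverse X) unique′)) (≡.trans δ≡ (cong suc (sym length-revX)))
            (stacks-path-fuel n (reverse X) w
              (subst (_≤ n) (sym length-revX) (≤-trans δ≤B B≤n))
              (subst (Linked (Adj G)) (unfold-reverse w X) (linked-reverse adj-sym
                (linked-prefix (w ∷ X) linked′)))
              (unique-resp-↭ (prep w (↭-sym (↭-reverse X)))
                (proj₁ (unique-++⁻ (w ∷ X) (proj₁ (proj₂ (unique-++⁻ [ v ] uniqueXY))))))))
          (stacks-path-fuel n Y v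
            (≤-trans (subst (_≤ length B) (sym (length-drop δ B)) (m∸n≤m (length B) δ)) B≤n)
            (linked-suffix (w ∷ X) linked′)
            (unique-rest uniqueXY))))
    where
    X Y : List (V G)
    X = take δ B
    Y = drop δ B
    -- The path is itself a walk from w to v, so there are enough vertices behind w to supply the
    -- cups needed for the distance.
    δ≤B : δ ≤ length B
    δ≤B = s≤s⁻¹ (subst (_≤ suc (length B)) δ≡ (proj₂ (isDist w v) _ (linked-walk G B linked)))
    length-revX : length (reverse X) ≡ δ
    length-revX = ≡.trans (length-reverse X) (≡.trans (length-take δ B) (m≤n⇒m⊓n≡m δ≤B))
    linked′ : Linked (Adj G) (w ∷ X ++ Y ++ [ v ])
    linked′ = subst (Linked (Adj G)) (cong (w ∷_)
                (≡.trans (cong (_++ [ v ]) (sym (take++drop≡id δ B))) (++-assoc X Y [ v ]))) linked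
    uniqueXY : Unique (v ∷ w ∷ X ++ Y)
    uniqueXY = subst (λ z → Unique (v ∷ w ∷ z)) (sym (take++drop≡id δ B)) unique
    unique′ : Unique (v ∷ w ∷ reverse X ++ Y)
    unique′ = unique-resp-↭ (prep v (prep w (++⁺ʳ Y (↭-sym (↭-reverse X))))) uniqueXY
    unique-rest : Unique (v ∷ w ∷ X ++ Y) → Unique (v ∷ Y)
    unique-rest ((_ ∷ a) ∷ (_ ∷ u)) = All.++⁻ʳ X a ∷ proj₁ (proj₂ (unique-++⁻ X u))

  stacks-within-path : ∀ A v B → Linked (Adj G) (A ++ v ∷ B) → Unique (A ++ v ∷ B) → Stacks v (A ++ B)
  stacks-within-path A v B linked unique =
    stacks-++ A unique′
      (stacks-path-fuel (length A) A v ≤-refl (linked-upto A linked) (proj₁ (unique-++⁻ (v ∷ A) unique′)))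
      (stacks-↭ (↭-reverse B) (stacks-path-fuel (length B) (reverse B) v (≤-reflexive (length-reverse B))
        (subst (Linked (Adj G)) (unfold-reverse v B) (linked-reverse adj-sym (linked-suffix A linked)))
        (unique-resp-↭ (prep v (↭-sym (↭-reverse B))) (proj₁ (proj₂ (unique-++⁻ A unique))))))
    where
    unique′ : Unique (v ∷ A ++ B)
    unique′ = unique-resp-↭ (shift v A B) unique

  -- Both arms of the segment are gathered on v, which then carries as many cups as its distance to
  -- t, and one move finishes.
  stacks-segment : ∀ {t} A v B → Linked (Adj G) (A ++ v ∷ B) → Unique (A ++ v ∷ B) → t ∉ A ++ v ∷ B →
                   dist v t ≡ length (A ++ v ∷ B) → Stacks t (A ++ v ∷ B)
  stacks-segment {t} A v B linked unique t∉ δ = stacks-↭ (↭-sym (shift v A B))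
    (stacks-relay (All.¬Any⇒All¬ _ (λ t∈ → t∉ (∈-resp-↭ (↭-sym (shift v A B)) t∈)) ∷ unique-resp-↭ (shift v A B) unique)
      (≡.trans δ (↭-length (shift v A B))) (stacks-within-path A v B linked unique))

  -- Continues a finite path for ever by bouncing over its last edge, which gives `Cuts` a total
  -- sequence with steps of one. Only cuts up to the length of the path are used.
  zigzag : V G → V G → List (V G) → ℕ → V G
  zigzag x y zs zero = x
  zigzag x y [] (suc i) = zigzag y x [] i
  zigzag x y (z ∷ zs) (suc i) = zigzag y z zs i

  zigzag-adj : ∀ x y zs → Linked (Adj G) (x ∷ y ∷ zs) → ∀ i → Adj G (zigzag x y zs i) (zigzag x y zs (suc i))
  zigzag-adj x y [] (r ∷ _) zero = r
  zigzag-adj x y (z ∷ zs) (r ∷ _) zero = r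
  zigzag-adj x y [] (r ∷ _) (suc i) = zigzag-adj y x [] (adj-sym r ∷ [-]) i
  zigzag-adj x y (z ∷ zs) (_ ∷ l) (suc i) = zigzag-adj y z zs l i

  zigzag-∈ : ∀ x y zs i → zigzag x y zs i ∈ x ∷ y ∷ zs
  zigzag-∈ x y zs zero = here refl
  zigzag-∈ x y [] (suc i) with zigzag-∈ y x [] i
  ... | here e = there (here e)
  ... | there (here e) = here e
  zigzag-∈ x y (z ∷ zs) (suc i) = there (zigzag-∈ y z zs i)

  zigzag-at : ∀ x y zs A v B → x ∷ y ∷ zs ≡ A ++ v ∷ B → zigzag x y zs (length A) ≡ v
  zigzag-at x y zs [] v B refl = refl
  zigzag-at x y (z ∷ zs) (a ∷ A) v B e = zigzag-at y z zs A v B (∷-injectiveʳ e)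
  zigzag-at x y [] (a ∷ []) v B refl = refl
  zigzag-at x y [] (a ∷ b ∷ []) v B ()
  zigzag-at x y [] (a ∷ b ∷ c ∷ A) v B ()

  module Long (t : V G) (M : ℕ) (2≤M : 2 ≤ M) (bounded : ∀ x → dist x t ≤ suc M)
              (alternating : ∀ {x y} → Adj G x y → dist x t ↕ dist y t) where

    stacks-long-path : ∀ P → Linked (Adj G) P → Unique P → t ∉ P → NoSquare G P →
                       M * M + 4 ≤ length P → Stacks t P
    stacks-long-path P linked unique t∉ noSq long = prepare P (≤-trans (m≤n+m 4 (M * M)) long) refl
      where
      prepare : ∀ Q → 4 ≤ length Q → Q ≡ P → Stacks t P
      prepare (x₀ ∷ x₁ ∷ x₂ ∷ x₃ ∷ xs) (s≤s (s≤s (s≤s (s≤s _)))) refl =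
        subst (Stacks t) (take-all (length P) P ≤-refl)
          (prefix (from (length P) (≤-trans a≤ long)) ≤-refl)
        where
        g : ℕ → V G
        g = zigzag x₀ x₁ (x₂ ∷ x₃ ∷ xs)
        f : ℕ → ℕ
        f i = dist (g i) t
        open Cuts f M (λ i → dist≢0 (λ e → t∉ (subst (_∈ P) e (zigzag-∈ x₀ x₁ _ i)))) (λ i → bounded (g i))
                  (λ i → alternating (zigzag-adj x₀ x₁ _ linked i))
        adjacent : ∀ {x} → dist x t ≡ 1 → Adj G x t
        adjacent {x} e with subst (Walk G x t) e (proj₁ (isDist x t))
        ... | step r here = r
        -- Value 1 at positions 1 and 3 would make t the fourth vertex of a square on x₁, x₂, x₃.
        not-square : ¬ (f 1 ≡ 1 × f 3 ≡ 1)
        not-square (e₁ , e₃) = noSq t (g 1) (g 2) (g 3) t∉ (zigzag-∈ x₀ x₁ _ 1) (zigzag-∈ x₀ x₁ _ 2) (zigzag-∈ x₀ x₁ _ 3)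
          (zigzag-adj x₀ x₁ _ linked 1) (zigzag-adj x₀ x₁ _ linked 2)
          (g₁≢g₃ unique) (adjacent e₁) (adjacent e₃)
          where
          g₁≢g₃ : Unique P → g 1 ≢ g 3
          g₁≢g₃ (_ ∷ ((_ ∷ p ∷ _) ∷ _)) e = p (≡.trans e (zigzag-at x₀ x₁ _ (x₀ ∷ x₁ ∷ x₂ ∷ []) x₃ xs refl))
        a = proj₁ (eventually-cut 2≤M not-square)
        a≤ = proj₁ (proj₂ (eventually-cut 2≤M not-square))
        from = proj₂ (proj₂ (eventually-cut 2≤M not-square))
        take-+ : ∀ i n (ys : List (V G)) → take (i + n) ys ≡ take i ys ++ take n (drop i ys)
        take-+ zero n ys = refl
        take-+ (suc i) zero [] = refl
        take-+ (suc i) (suc n) [] = refl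
        take-+ (suc i) n (y ∷ ys) = cong (y ∷_) (take-+ i n ys)
        prefix : ∀ {j} → Cut j → j ≤ length P → Stacks t (take j P)
        prefix start _ = stacks-[]
        prefix (next {i} {n} c (l , l<n , fl)) i+n≤ =
          subst (Stacks t) (sym (take-+ i n P)) (stacks-++ (take i P) unique-t (prefix c i≤) segment)
          where
          I J : List (V G)
          I = take n (drop i P)
          J = drop n (drop i P)
          i≤ : i ≤ length P
          i≤ = ≤-trans (m≤m+n i n) i+n≤
          P≡ : take i P ++ I ++ J ≡ P
          P≡ = ≡.trans (cong (take i P ++_) (take++drop≡id n (drop i P))) (take++drop≡id i P)
          P≡′ : (take i P ++ I) ++ J ≡ P
          P≡′ = ≡.trans (++-assoc (take i P) I J) P≡
          length-I : length I ≡ n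
          length-I = ≡.trans (length-take n (drop i P)) (m≤n⇒m⊓n≡m
            (subst (n ≤_) (sym (length-drop i P)) (m+n≤o⇒m≤o∸n n (subst (_≤ length P) (+-comm i n) i+n≤))))
          t∉P₁ : t ∉ take i P ++ I
          t∉P₁ t∈ = t∉ (subst (t ∈_) P≡′ (∈-++⁺ˡ t∈))
          unique₁ : Unique (take i P ++ I)
          unique₁ = proj₁ (unique-++⁻ (take i P ++ I) (subst Unique (sym P≡′) unique))
          unique-t : Unique (t ∷ take i P ++ I)
          unique-t = All.¬Any⇒All¬ _ t∉P₁ ∷ unique₁
          linked-I : Linked (Adj G) I
          linked-I = linked-prefix I (linked-suffix (take i P) (subst (Linked (Adj G)) (sym P≡) linked))
          segment : Stacks t I
          segment with split-at I l (subst (l <_) (sym length-I) l<n)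
          ... | A , v , B , I≡ , A≡ = subst (Stacks t) (sym I≡)
              (stacks-segment A v B (subst (Linked (Adj G)) I≡ linked-I)
                (subst Unique I≡ (proj₁ (proj₂ (unique-++⁻ (take i P) unique₁))))
                (λ t∈ → t∉P₁ (∈-++⁺ʳ (take i P) (subst (t ∈_) (sym I≡) t∈)))
                (≡.trans (cong (λ z → dist z t) (sym at)) (≡.trans fl (≡.trans (sym length-I) (cong length I≡)))))
            where
            at : g (i + l) ≡ v
            at = subst (λ z → g z ≡ v)
              (≡.trans (length-++ (take i P)) (≡.cong₂ _+_ (≡.trans (length-take i P) (m≤n⇒m⊓n≡m i≤)) A≡))
              (zigzag-at x₀ x₁ _ (take i P ++ A) v (B ++ J)
                (≡.trans (sym P≡) (≡.trans (cong (λ z → take i P ++ z ++ J) I≡)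
                  (≡.trans (cong (take i P ++_) (++-assoc A (v ∷ B) J)) (sym (++-assoc (take i P) A (v ∷ B ++ J)))))))

  -- Treats the path through t and the paths avoiding it alike. Only positivity is recorded at t,
  -- since the pile there grows from path to path.
  Clears : V G → List (V G) → Set
  Clears t P = ∀ c → 1 ≤ c t → (∀ x → x ∈ P → x ≢ t → c x ≡ 1) → ∃ λ c′ →
    Star (Move G) c c′ × 1 ≤ c′ t × (∀ x → x ∈ P → x ≢ t → c′ x ≡ 0) × (∀ x → x ≢ t → x ∉ P → c′ x ≡ c x)

  clears : ∀ {t B P} → Unique (t ∷ B) → (∀ x → x ∈ B → x ∈ P) → (∀ x → x ∈ P → x ≢ t → x ∈ B) →
           Stacks t B → Clears t P
  clears {t} u B⊆P P⊆B st c ct ones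
    with st c ct (λ x x∈ → ones x (B⊆P x x∈) (λ { refl → unique-∉ u x∈ }))
  ... | c′ , moves , total , zeros , rest =
    c′ , moves , ≤-trans ct (subst (c t ≤_) (sym total) (m≤m+n _ _)) ,
    (λ x x∈ x≢t → zeros x (P⊆B x x∈ x≢t)) , λ x x≢t x∉ → rest x x≢t (λ x∈ → x∉ (B⊆P x x∈))

  clears-own-path : ∀ {t P} → t ∈ P → Linked (Adj G) P → Unique P → Clears t P
  clears-own-path {t} t∈ linked unique with ∈-∃++ t∈
  ... | A , B , refl = clears {B = A ++ B} (unique-resp-↭ (shift t A B) unique)
    (λ x x∈ → ∈-resp-↭ (↭-sym (shift t A B)) (there x∈))
    (λ x x∈ x≢t → strip x≢t (∈-resp-↭ (shift t A B) x∈))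
    (stacks-within-path A t B linked unique)
    where strip : ∀ {x} → x ≢ t → x ∈ t ∷ A ++ B → x ∈ A ++ B
          strip x≢t (here e) = ⊥-elim (x≢t e)
          strip x≢t (there x∈) = x∈

  clears-other-path : ∀ {t P} → t ∉ P → Unique P → Stacks t P → Clears t P
  clears-other-path t∉ u st = clears (All.¬Any⇒All¬ _ t∉ ∷ u) (λ _ x∈ → x∈) (λ _ x∈ _ → x∈) st

  clears-all : ∀ {t} Ps → AllPairs Disjoint Ps → All (Clears t) Ps → ∀ c → 1 ≤ c t →
    (∀ P x → P ∈ Ps → x ∈ P → x ≢ t → c x ≡ 1) → ∃ λ c′ → Star (Move G) c c′ ×
    (∀ P x → P ∈ Ps → x ∈ P → x ≢ t → c′ x ≡ 0) × (∀ x → x ≢ t → (∀ P → P ∈ Ps → x ∉ P) → c′ x ≡ c x)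
  clears-all [] _ _ c _ _ = c , ε , (λ _ _ ()) , λ _ _ _ → refl
  clears-all {t} (P ∷ Ps) (d ∷ ds) (clr ∷ clrs) c ct ones with clr c ct (λ x → ones P x (here refl))
  ... | c₁ , moves₁ , ct₁ , zeros₁ , rest₁
    with clears-all Ps ds clrs c₁ ct₁ (λ Q x Q∈ x∈ x≢t → ≡.trans (rest₁ x x≢t (λ x∈P → All.lookup d Q∈ (x∈P , x∈)))
           (ones Q x (there Q∈) x∈ x≢t))
  ... | c₂ , moves₂ , zeros₂ , rest₂ = c₂ , moves₁ ◅◅ moves₂ ,
    (λ { Q x (here refl) x∈ x≢t → ≡.trans (rest₂ x x≢t (λ R R∈ x∈R → All.lookup d R∈ (x∈ , x∈R))) (zeros₁ x x∈ x≢t)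
       ; Q x (there Q∈) x∈ x≢t → zeros₂ Q x Q∈ x∈ x≢t }) ,
    λ x x≢t x∉ → ≡.trans (rest₂ x x≢t (λ R R∈ → x∉ R (there R∈))) (rest₁ x x≢t (x∉ P (here refl)))

-- Products

module _ (G : Graph) where

  walk-++ : ∀ {x y z l l′} → Walk G x y l → Walk G y z l′ → Walk G x z (l + l′)
  walk-++ here w = w
  walk-++ (step r v) w = step r (walk-++ v w)

  walk-sym : Symmetric (Adj G) → ∀ {x y l} → Walk G x y l → Walk G y x l
  walk-sym s here = here
  walk-sym s {x} {z} {suc l} (step r w) = subst (Walk G z x) (+-comm l 1) (walk-++ (walk-sym s w) (step (s r) here))

  Colouring : Set
  Colouring = Σ (V G → Bool) λ colour → ∀ {x y} → Adj G x y → colour y ≡ not (colour x)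

  module _ (colouring : Colouring) where
    private colour = proj₁ colouring

    flips : ℕ → Bool → Bool
    flips zero b = b
    flips (suc l) b = flips l (not b)

    flips-not : ∀ l b → flips l (not b) ≢ flips l b
    flips-not zero b e = not-¬ {b} refl (sym e)
    flips-not (suc l) b = flips-not l (not b)

    walk-colour : ∀ {x y l} → Walk G x y l → colour y ≡ flips l (colour x)
    walk-colour here = refl
    walk-colour {l = suc l} (step r w) = ≡.trans (walk-colour w) (cong (flips l) (proj₂ colouring r))

    -- Adjacent distances differ by at most one. Were they equal, two vertices of different colours
    -- would have walks of the same length to t.
    dist-↕ : (metric : Metric G) → let open Metric metric in
             ∀ t {x y} → Adj G x y → dist x t ↕ dist y t
    dist-↕ metric t {x} {y} r with m≤n⇒m<n∨m≡n x≤ | m≤n⇒m<n∨m≡n y≤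
      where
      open Metric metric
      x≤ : dist x t ≤ suc (dist y t)
      x≤ = proj₂ (isDist x t) _ (step r (proj₁ (isDist y t)))
      y≤ : dist y t ≤ suc (dist x t)
      y≤ = proj₂ (isDist y t) _ (step (adj-sym r) (proj₁ (isDist x t)))
    ... | inj₂ e | _ = inj₂ e
    ... | inj₁ _ | inj₂ e = inj₁ e
    ... | inj₁ (s≤s x≤) | inj₁ (s≤s y≤) = ⊥-elim (flips-not (dist x t) (colour x) (≡.trans
            (cong (flips (dist x t)) (sym (proj₂ colouring r)))
            (≡.trans (sym (walk-colour (subst (Walk G y t) (≤-antisym y≤ x≤) (proj₁ (isDist y t)))))
              (walk-colour (proj₁ (isDist x t))))))
      where open Metric metric

-- Boustrophedon order: each row runs against the previous one, so consecutive rows meet in the same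
-- second coordinate.
snake : {A B : Set} → List A → List B → List (A × B)
snake [] ys = []
snake (x ∷ xs) ys = map (x ,_) ys ++ snake xs (reverse ys)

module _ {A B : Set} where

  ∈-snake⁻ : ∀ (xs : List A) (ys : List B) {p} → p ∈ snake xs ys → proj₁ p ∈ xs × proj₂ p ∈ ys
  ∈-snake⁻ (x ∷ xs) ys p∈ with ∈-++⁻ (map (x ,_) ys) p∈
  ... | inj₁ q with ∈-map⁻ (x ,_) q
  ...   | y , y∈ , refl = here refl , y∈
  ∈-snake⁻ (x ∷ xs) ys p∈ | inj₂ q with ∈-snake⁻ xs (reverse ys) q
  ...   | a , b = there a , Any.reverse⁻ b

  ∈-snake⁺ : ∀ (xs : List A) (ys : List B) {x y} → x ∈ xs → y ∈ ys → (x , y) ∈ snake xs ys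
  ∈-snake⁺ (x ∷ xs) ys (here refl) y∈ = ∈-++⁺ˡ (∈-map⁺ (x ,_) y∈)
  ∈-snake⁺ (x ∷ xs) ys (there x∈) y∈ = ∈-++⁺ʳ (map (x ,_) ys) (∈-snake⁺ xs (reverse ys) x∈ (Any.reverse⁺ y∈))

  snake-unique : ∀ (xs : List A) (ys : List B) → Unique xs → Unique ys → Unique (snake xs ys)
  snake-unique [] ys _ _ = []
  snake-unique (x ∷ xs) ys u@(_ ∷ uxs) uys =
    Unique.++⁺ (Unique.map⁺ (λ { refl → refl }) uys)
      (snake-unique xs (reverse ys) uxs (unique-resp-↭ (↭-sym (↭-reverse ys)) uys)) disjoint
    where
    disjoint : Disjoint (map (x ,_) ys) (snake xs (reverse ys))
    disjoint (p , q) with ∈-map⁻ (x ,_) p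
    ... | y , _ , refl = unique-∉ u (proj₁ (∈-snake⁻ xs (reverse ys) q))

  length-snake : ∀ (xs : List A) (ys : List B) → length (snake xs ys) ≡ length xs * length ys
  length-snake [] ys = refl
  length-snake (x ∷ xs) ys = ≡.trans (length-++ (map (x ,_) ys))
    (cong₂ _+_ (length-map (x ,_) ys)
      (≡.trans (length-snake xs (reverse ys)) (cong (length xs *_) (length-reverse ys))))

  snake-[] : ∀ (xs : List A) → snake {B = B} xs [] ≡ []
  snake-[] [] = refl
  snake-[] (x ∷ xs) = snake-[] xs

  snake-disjointˡ : ∀ {xs xs′ : List A} → Disjoint xs xs′ → ∀ (ys ys′ : List B) → Disjoint (snake xs ys) (snake xs′ ys′)
  snake-disjointˡ {xs} {xs′} d ys ys′ (u , v) = d (proj₁ (∈-snake⁻ xs ys u) , proj₁ (∈-snake⁻ xs′ ys′ v))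

  snake-disjointʳ : ∀ (xs : List A) {ys ys′ : List B} → Disjoint ys ys′ → Disjoint (snake xs ys) (snake xs ys′)
  snake-disjointʳ xs {ys} {ys′} d (u , v) = d (proj₂ (∈-snake⁻ xs ys u) , proj₂ (∈-snake⁻ xs ys′ v))

module _ {G H : Graph} where

  snake-linked : Symmetric (Adj H) → ∀ xs ys → Linked (Adj G) xs → Linked (Adj H) ys →
                 Linked (Adj (G □ H)) (snake xs ys)
  snake-linked s [] ys lx ly = []
  snake-linked s (x ∷ []) ys lx ly = subst (Linked _) (sym (++-identityʳ _))
    (Linked.map⁺ (Linked.map (λ r → inj₁ (refl , r)) ly))
  snake-linked s (x ∷ x′ ∷ xs) ys (r ∷ lx) ly with reverse ys in eq | snake-linked s (x′ ∷ xs) (reverse ys) lx (linked-reverse s ly)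
  ... | [] | _ rewrite ≡.trans (sym (reverse-involutive ys)) (cong reverse eq) | snake-[] {B = V H} xs = []
  ... | l ∷ zs | ih = subst (Linked _)
      (≡.trans (sym (++-assoc (map (x ,_) (reverse zs)) [ x , l ] _))
        (cong (_++ snake (x′ ∷ xs) (l ∷ zs)) (≡.trans (sym (map-++ (x ,_) (reverse zs) [ l ])) (cong (map (x ,_)) (sym ys≡)))))
      (linked-glue (map (x ,_) (reverse zs))
        (subst (Linked _) (≡.trans (cong (map (x ,_)) ys≡) (map-++ (x ,_) (reverse zs) [ l ]))
          (Linked.map⁺ (Linked.map (λ r → inj₁ (refl , r)) ly)))
        (inj₂ (r , refl) ∷ ih))
    where
    ys≡ : ys ≡ reverse zs ++ [ l ]
    ys≡ = ≡.trans (sym (reverse-involutive ys)) (≡.trans (cong reverse eq) (unfold-reverse l zs))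

  -- If the two edges at t lie in different factors, the coordinates of t come from x and z, so t
  -- lies on the snake. If they lie in the same factor, x and z agree in the other one, and the two
  -- steps through y form a square in the first, contain a loop of the other, or lead back to x.
  snake-noSquare : (∀ {x} → ¬ Adj G x x) → (∀ {y} → ¬ Adj H y y) → ∀ xs ys →
                   NoSquare G xs → NoSquare H ys → NoSquare (G □ H) (snake xs ys)
  snake-noSquare irrG irrH xs ys nG nH (t₁ , t₂) (a₁ , a₂) (b₁ , b₂) (c₁ , c₂) t∉ a∈ b∈ c∈ ab bc a≢c at ct =
    go ab bc at ct
    where
    a₁∈ = proj₁ (∈-snake⁻ xs ys a∈)
    b₁∈ = proj₁ (∈-snake⁻ xs ys b∈)
    c₁∈ = proj₁ (∈-snake⁻ xs ys c∈)
    a₂∈ = proj₂ (∈-snake⁻ xs ys a∈)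
    b₂∈ = proj₂ (∈-snake⁻ xs ys b∈)
    c₂∈ = proj₂ (∈-snake⁻ xs ys c∈)
    go : Adj (G □ H) (a₁ , a₂) (b₁ , b₂) → Adj (G □ H) (b₁ , b₂) (c₁ , c₂) →
         Adj (G □ H) (a₁ , a₂) (t₁ , t₂) → Adj (G □ H) (c₁ , c₂) (t₁ , t₂) → ⊥
    go _ _ (inj₁ (refl , _)) (inj₂ (_ , refl)) = t∉ (∈-snake⁺ xs ys a₁∈ c₂∈)
    go _ _ (inj₂ (_ , refl)) (inj₁ (refl , _)) = t∉ (∈-snake⁺ xs ys c₁∈ a₂∈)
    go (inj₁ (refl , p)) (inj₁ (refl , q)) (inj₁ (refl , u)) (inj₁ (_ , v)) =
      nH t₂ a₂ b₂ c₂ (λ t₂∈ → t∉ (∈-snake⁺ xs ys a₁∈ t₂∈)) a₂∈ b₂∈ c₂∈ p q (λ { refl → a≢c refl }) u v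
    go (inj₁ (refl , p)) (inj₂ (q , refl)) (inj₁ (refl , u)) (inj₁ (refl , v)) = irrG q
    go (inj₂ (p , refl)) (inj₁ (refl , q)) (inj₁ (refl , u)) (inj₁ (refl , v)) = irrG p
    go (inj₂ (p , refl)) (inj₂ (q , refl)) (inj₁ (refl , u)) (inj₁ (refl , v)) = a≢c refl
    go (inj₂ (p , refl)) (inj₂ (q , refl)) (inj₂ (u , refl)) (inj₂ (v , _)) =
      nG t₁ a₁ b₁ c₁ (λ t₁∈ → t∉ (∈-snake⁺ xs ys t₁∈ a₂∈)) a₁∈ b₁∈ c₁∈ p q (λ { refl → a≢c refl }) u v
    go (inj₁ (refl , p)) (inj₂ (q , refl)) (inj₂ (u , refl)) (inj₂ (v , refl)) = irrH p
    go (inj₂ (p , refl)) (inj₁ (refl , q)) (inj₂ (u , refl)) (inj₂ (v , refl)) = irrH q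
    go (inj₁ (refl , p)) (inj₁ (refl , q)) (inj₂ (u , refl)) (inj₂ (v , refl)) = a≢c refl

  □-irrefl : (∀ {x} → ¬ Adj G x x) → (∀ {y} → ¬ Adj H y y) → ∀ {p} → ¬ Adj (G □ H) p p
  □-irrefl irrG irrH (inj₁ (_ , r)) = irrH r
  □-irrefl irrG irrH (inj₂ (r , _)) = irrG r

  □-colouring : Colouring G → Colouring H → Colouring (G □ H)
  □-colouring (c , p) (d , q) = (λ x → c (proj₁ x) xor d (proj₂ x)) , λ
    { {x} {y} (inj₁ (e , r)) → ≡.trans (cong₂ _xor_ (cong c (sym e)) (q r)) (sym (not-distribʳ-xor (c (proj₁ x)) (d (proj₂ x))))
    ; {x} {y} (inj₂ (r , e)) → ≡.trans (cong₂ _xor_ (p r) (cong d (sym e))) (sym (not-distribˡ-xor (c (proj₁ x)) (d (proj₂ x)))) }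

  □-walk : ∀ {x x′ y y′ l l′} → Walk G x x′ l → Walk H y y′ l′ → Walk (G □ H) (x , y) (x′ , y′) (l + l′)
  □-walk here here = here
  □-walk here (step r w) = step (inj₁ (refl , r)) (□-walk here w)
  □-walk (step r v) w = step (inj₂ (r , refl)) (□-walk v w)

  □-unwalk : ∀ {p q l} → Walk (G □ H) p q l → ∃ λ l₁ → ∃ λ l₂ →
             Walk G (proj₁ p) (proj₁ q) l₁ × Walk H (proj₂ p) (proj₂ q) l₂ × l₁ + l₂ ≡ l
  □-unwalk here = 0 , 0 , here , here , refl
  □-unwalk (step r w) with □-unwalk w | r
  ... | l₁ , l₂ , v₁ , v₂ , refl | inj₁ (refl , r₂) = l₁ , suc l₂ , v₁ , step r₂ v₂ , +-suc l₁ l₂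
  ... | l₁ , l₂ , v₁ , v₂ , refl | inj₂ (r₁ , refl) = suc l₁ , l₂ , step r₁ v₁ , v₂ , refl

  □-metric : Metric G → Metric H → Metric (G □ H)
  □-metric μ ν = record
    { _≟V_ = Product.≡-dec (_≟V_ μ) (_≟V_ ν)
    ; adj-sym = λ { (inj₁ (e , r)) → inj₁ (sym e , adj-sym ν r) ; (inj₂ (r , e)) → inj₂ (adj-sym μ r , sym e) }
    ; dist = λ p q → dist μ (proj₁ p) (proj₁ q) + dist ν (proj₂ p) (proj₂ q)
    ; isDist = λ p q → □-walk (proj₁ (isDist μ _ _)) (proj₁ (isDist ν _ _)) , λ l w →
        let l₁ , l₂ , w₁ , w₂ , e = □-unwalk w
        in subst (_ ≤_) e (+-mono-≤ (proj₂ (isDist μ _ _) l₁ w₁) (proj₂ (isDist ν _ _) l₂ w₂)) }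
    where open Metric

-- Decompositions into long paths, and stackability from them

record LongPath (G : Graph) (K c : ℕ) (P : List (V G)) : Set where
  field
    linked   : Linked (Adj G) P
    unique   : Unique P
    noSquare : NoSquare G P
    -- Length at least K / c, without division, so that products of paths simply multiply both
    -- numbers.
    long     : K ≤ c * length P

record Decomposition (G : Graph) (K c : ℕ) : Set where
  field
    paths    : List (List (V G))
    areLong  : All (LongPath G K c) paths
    disjoint : AllPairs Disjoint paths
    covers   : ∀ x → ∃ λ P → P ∈ paths × x ∈ P

module _ {G H : Graph} (symH : Symmetric (Adj H)) (irrG : ∀ {x} → ¬ Adj G x x) (irrH : ∀ {y} → ¬ Adj H y y)
         {K c K′ c′ : ℕ} where

  □-longPath : ∀ {P Q} → LongPath G K c P → LongPath H K′ c′ Q → LongPath (G □ H) (K * K′) (c * c′) (snake P Q)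
  □-longPath {P} {Q} p q = record
    { linked = snake-linked symH P Q (linked p) (linked q)
    ; unique = snake-unique P Q (unique p) (unique q)
    ; noSquare = snake-noSquare irrG irrH P Q (noSquare p) (noSquare q)
    ; long = subst (K * K′ ≤_) eq (*-mono-≤ (long p) (long q)) }
    where
    open LongPath
    open +-*-Solver
    eq : c * length P * (c′ * length Q) ≡ c * c′ * length (snake P Q)
    eq = ≡.trans (solve 4 (λ a x b y → a :* x :* (b :* y) := a :* b :* (x :* y)) refl c (length P) c′ (length Q))
           (cong (c * c′ *_) (sym (length-snake P Q)))

  □-decomposition : Decomposition G K c → Decomposition H K′ c′ → Decomposition (G □ H) (K * K′) (c * c′)
  □-decomposition 𝒫 𝒬 = record
    { paths = cartesianProductWith snake (paths 𝒫) (paths 𝒬)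
    ; areLong = longs (areLong 𝒫)
    ; disjoint = disjoints (paths 𝒫) (disjoint 𝒫)
    ; covers = λ { (x , y) → let P , P∈ , x∈ = covers 𝒫 x ; Q , Q∈ , y∈ = covers 𝒬 y
                             in snake P Q , ∈-cartesianProductWith⁺ snake P∈ Q∈ , ∈-snake⁺ P Q x∈ y∈ } }
    where
    open Decomposition
    longs : ∀ {Ps} → All (LongPath G K c) Ps → All (LongPath (G □ H) (K * K′) (c * c′)) (cartesianProductWith snake Ps (paths 𝒬))
    longs [] = []
    longs (p ∷ ps) = All.++⁺ (All.map⁺ (All.map (□-longPath p) (areLong 𝒬))) (longs ps)
    apart : ∀ {P Ps} → All (Disjoint P) Ps → ∀ Q → All (Disjoint (snake P Q)) (cartesianProductWith snake Ps (paths 𝒬))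
    apart [] Q = []
    apart (d ∷ ds) Q = All.++⁺ (All.map⁺ (All.universal (snake-disjointˡ d Q) (paths 𝒬))) (apart ds Q)
    disjoints : ∀ Ps → AllPairs Disjoint Ps → AllPairs Disjoint (cartesianProductWith snake Ps (paths 𝒬))
    disjoints [] [] = []
    disjoints (P ∷ Ps) (d ∷ ds) = AllPairs.++⁺
      (AllPairs.map⁺ (AllPairs.map (snake-disjointʳ P) (disjoint 𝒬)))
      (disjoints Ps ds)
      (All.map⁺ (All.universal (apart d) (paths 𝒬)))

stackable : ∀ {G} (metric : Metric G) → Colouring G → ∀ M → 2 ≤ M →
  (∀ x y → Metric.dist metric x y ≤ suc M) → ∀ {K c} → (∀ n → K ≤ c * n → M * M + 4 ≤ n) →
  Decomposition G K c → Stackable G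
stackable {G} metric colouring M 2≤M bounded {K} {c} large 𝒫 t =
  let c′ , moves , zeros , _ = clears-all paths disjoint (All.map clear areLong) (λ _ → 1) ≤-refl (λ _ _ _ _ _ → refl)
  in c′ , moves , λ x x≢t → let P , P∈ , x∈ = covers x in zeros P x P∈ x∈ x≢t
  where
  open Metric metric
  open Decomposition 𝒫
  open Stacking G metric
  open DecMembership _≟V_ using (_∈?_)
  open Long t M 2≤M (λ x → bounded x t) (dist-↕ G colouring metric t)
  clear : ∀ {P} → LongPath G K c P → Clears t P
  clear {P} p with t ∈? P
  ... | yes t∈ = clears-own-path t∈ (LongPath.linked p) (LongPath.unique p)
  ... | no t∉ = clears-other-path t∉ (LongPath.unique p)
        (stacks-long-path P (LongPath.linked p) (LongPath.unique p) t∉ (LongPath.noSquare p) (large (length P) (LongPath.long p)))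

cube-stackable : ∀ {G} (metric : Metric G) → Colouring G → (∀ {x} → ¬ Adj G x x) → ∀ D K → 1 ≤ D →
  (∀ x y → Metric.dist metric x y ≤ D) → 72 * (D * D) ≤ K * (K * K) → Decomposition G K 2 → Stackable (cube G)
cube-stackable {G} metric colouring irr D@(suc D′) K 1≤D bounded large 𝒫 =
  stackable (□-metric metric (□-metric metric metric)) (□-colouring colouring (□-colouring colouring colouring))
    -- This M is 3D - 1, making `suc M` the bound 3D on a sum of three distances.
    (2 + 3 * D′) (s≤s (s≤s z≤n))
    (λ (x₁ , x₂ , x₃) (y₁ , y₂ , y₃) → ≤-trans (+-mono-≤ (bounded x₁ y₁) (+-mono-≤ (bounded x₂ y₂) (bounded x₃ y₃)))
      (≤-reflexive (solve 1 (λ d → con 1 :+ d :+ (con 1 :+ d :+ (con 1 :+ d)) := con 3 :+ con 3 :* d) refl D′)))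
    volume
    (□-decomposition (Metric.adj-sym (□-metric metric metric)) irr (□-irrefl {G} {G} irr irr) 𝒫 (□-decomposition (Metric.adj-sym metric) irr irr 𝒫 𝒫))
  where
  open +-*-Solver
  -- The three factors 2 give the 8, and 72 = 8 * 9 leaves n at least 9D². This exceeds (3D - 1)² +
  -- 4 because D is positive.
  volume : ∀ n → K * (K * K) ≤ 8 * n → (2 + 3 * D′) * (2 + 3 * D′) + 4 ≤ n
  volume n le = ≤-trans
    (≤-trans (m≤m+n _ (1 + 6 * D′)) (≤-reflexive
      (solve 1 (λ d → (con 2 :+ con 3 :* d) :* (con 2 :+ con 3 :* d) :+ con 4 :+ (con 1 :+ con 6 :* d)
                      := con 9 :* ((con 1 :+ d) :* (con 1 :+ d))) refl D′)))
    (*-cancelˡ-≤ 8 (≤-trans (≤-reflexive (sym (*-assoc 8 9 (D * D)))) (≤-trans large le)))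

-- Rooted trees

odd : ℕ → Bool
odd zero = false
odd (suc n) = not (odd n)

odd-↕ : ∀ {a b} → a ↕ b → odd b ≡ not (odd a)
odd-↕ (inj₁ refl) = refl
odd-↕ {a} {b} (inj₂ refl) = sym (not-involutive (odd b))

module _ (G : Graph) (_≟ᵛ_ : DecidableEquality (V G)) (adj? : Decidable₂ (Adj G))
         (vertices : List (V G)) (complete : ∀ x → x ∈ vertices) where

  walk? : ∀ l x y → Dec (Walk G x y l)
  walk? zero x y = map′ (λ { refl → here }) (λ { here → refl }) (x ≟ᵛ y)
  walk? (suc l) x y = map′ from to
    (Any.any? (λ z → adj? x z ×-dec walk? l z y) vertices)
    where
    from : Any.Any (λ z → Adj G x z × Walk G z y l) vertices → Walk G x y (suc l)
    from a with find a
    ... | _ , _ , r , w = step r w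
    to : Walk G x y (suc l) → Any.Any (λ z → Adj G x z × Walk G z y l) vertices
    to (step r w) = lose (complete _) (r , w)

  finiteMetric : Symmetric (Adj G) → Connected G → Metric G
  finiteMetric s connected = record
    { _≟V_ = _≟ᵛ_ ; adj-sym = s ; dist = λ x y → proj₁ (shortest x y)
    ; isDist = λ x y → let _ , _ , w , min = shortest x y in w , min }
    where
    shortest = λ x y → least (λ l → walk? l x y) _ (proj₂ (connected x y))

module _ {A : Set} (_≟ᵛ_ : DecidableEquality A) (R : A → A → Set) where
  open DecMembership _≟ᵛ_ using (_∈?_)

  data Route : A → A → List A → Set where
    stop : ∀ {x} → Route x x []
    hop   : ∀ {x y z vs} → R x y → Route y z vs → Route x z (y ∷ vs)

  cut-route : ∀ {x y z vs} → x ∈ y ∷ vs → Route y z vs → Unique (y ∷ vs) → ∃ λ ws → Route x z ws × Unique (x ∷ ws)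
  cut-route (here refl) r u = _ , r , u
  cut-route (there x∈) (hop _ r) (_ ∷ u) = cut-route x∈ r u

  erase-loops : ∀ {x y} → Star R x y → ∃ λ vs → Route x y vs × Unique (x ∷ vs)
  erase-loops ε = [] , stop , [] ∷ []
  erase-loops {x} (_◅_ {j = z} r rs) with erase-loops rs
  ... | vs , route , u with x ∈? z ∷ vs
  ...   | yes x∈ = cut-route x∈ route u
  ...   | no x∉ = z ∷ vs , hop r route , All.¬Any⇒All¬ _ x∉ ∷ u

module _ (G : Graph) (_≟ᵛ_ : DecidableEquality (V G)) (R : V G → V G → Set) (R⊆Adj : ∀ {x y} → R x y → Adj G x y) where

  route-chain : ∀ {x y z vs} → Route _≟ᵛ_ R x y vs → Adj G y z → Chain G (x ∷ vs ++ [ z ])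
  route-chain stop a = a , tt
  route-chain (hop r route) a = R⊆Adj r , route-chain route a

  -- The loop-erased R-walk is closed by the edge from y to x. As R does not relate x directly to y,
  -- it has the two further vertices that a cycle needs.
  detour-cycle : ∀ {x y} → x ≢ y → ¬ R x y → Adj G y x → Star R x y → HasCycle G
  detour-cycle x≢y ¬r a rs with erase-loops _≟ᵛ_ R rs
  ... | [] , stop , _ = ⊥-elim (x≢y refl)
  ... | _ ∷ [] , hop r stop , _ = ⊥-elim (¬r r)
  ... | v ∷ w ∷ vs , route , u = _ , _ , s≤s (s≤s z≤n) , u , route-chain route a

module Tree {n m : ℕ} (ends : Fin m → Fin n × Fin n) (simple : SimpleEdges ends) (isTree : IsTree (EdgeGraph ends))
            (k d : ℕ) (spread : HasSpread (EdgeGraph ends) k) (diameter : HasDiameter (EdgeGraph ends) d) where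

  T : Graph
  T = EdgeGraph ends

  T-sym : Symmetric (Adj T)
  T-sym (e , inj₁ p) = e , inj₂ p
  T-sym (e , inj₂ p) = e , inj₁ p

  T-irrefl : ∀ {x} → ¬ Adj T x x
  T-irrefl (e , inj₁ p) = proj₁ simple e (≡.trans (cong proj₁ p) (sym (cong proj₂ p)))
  T-irrefl (e , inj₂ p) = proj₁ simple e (≡.trans (cong proj₁ p) (sym (cong proj₂ p)))

  T-adj? : Decidable₂ (Adj T)
  T-adj? x y = any? λ e → Product.≡-dec _≟_ _≟_ (ends e) (x , y) ⊎-dec Product.≡-dec _≟_ _≟_ (ends e) (y , x)

  abstract
    T-metric : Metric T
    T-metric = finiteMetric T _≟_ T-adj? (allFin n) ∈-allFin T-sym (proj₁ isTree)

  open Metric T-metric using (dist; isDist) public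

  dist≤d : ∀ x y → dist x y ≤ d
  dist≤d x y = proj₂ diameter x y _ (isDist x y)

  -- With a leaf as root, the chain from the root joins two leaves, so the spread bounds its length
  -- directly.
  ρ : Fin n
  ρ = proj₁ (proj₁ spread)

  ρ-leaf : IsLeaf T ρ
  ρ-leaf = proj₁ (proj₂ (proj₂ (proj₁ spread)))

  dep : Fin n → ℕ
  dep x = dist x ρ

  abstract
    parent : ∀ x → Σ (Fin n) λ y → (x ≡ ρ × y ≡ ρ) ⊎ (x ≢ ρ × Adj T x y × dep x ≡ suc (dep y))
    parent x with x ≟ ρ | dist x ρ | isDist x ρ
    ... | yes x≡ρ | _ | _ = ρ , inj₁ (x≡ρ , refl)
    ... | no x≢ρ | zero | here , _ = ⊥-elim (x≢ρ refl)
    -- The first step of a shortest walk to ρ, whence the depth drops by exactly one.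
    ... | no x≢ρ | suc l | step {y = y} r w , min = y , inj₂ (x≢ρ , r ,
          ≤-antisym (min _ (step r (proj₁ (isDist y ρ)))) (s≤s (proj₂ (isDist y ρ) _ w)))

  par : Fin n → Fin n
  par x = proj₁ (parent x)

  par-ρ : par ρ ≡ ρ
  par-ρ with proj₂ (parent ρ)
  ... | inj₁ (_ , e) = e
  ... | inj₂ (ρ≢ρ , _) = ⊥-elim (ρ≢ρ refl)

  par-adj : ∀ {x} → x ≢ ρ → Adj T x (par x)
  par-adj {x} x≢ρ with proj₂ (parent x)
  ... | inj₁ (x≡ρ , _) = ⊥-elim (x≢ρ x≡ρ)
  ... | inj₂ (_ , r , _) = r

  par-dep : ∀ {x} → x ≢ ρ → dep x ≡ suc (dep (par x))
  par-dep {x} x≢ρ with proj₂ (parent x)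
  ... | inj₁ (x≡ρ , _) = ⊥-elim (x≢ρ x≡ρ)
  ... | inj₂ (_ , _ , e) = e

  TreeEdge : Fin n → Fin n → Set
  TreeEdge x y = Adj T x y × (y ≡ par x ⊎ x ≡ par y)

  TreeEdge-sym : Symmetric TreeEdge
  TreeEdge-sym (a , inj₁ e) = T-sym a , inj₂ e
  TreeEdge-sym (a , inj₂ e) = T-sym a , inj₁ e

  climb : ∀ g x → dep x ≤ g → Star TreeEdge x ρ
  climb g x le with x ≟ ρ
  ... | yes refl = ε
  climb zero x le | no x≢ρ = ⊥-elim (<⇒≱ (subst (0 <_) (sym (par-dep x≢ρ)) (s≤s z≤n)) le)
  climb (suc g) x le | no x≢ρ = (par-adj x≢ρ , inj₁ refl) ◅ climb g (par x) (s≤s⁻¹ (subst (_≤ suc g) (par-dep x≢ρ) le))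

  -- An edge joining no vertex to its parent would close a cycle with the climbs from its two ends
  -- to ρ.
  adj-par : ∀ {x y} → Adj T x y → y ≡ par x ⊎ x ≡ par y
  adj-par {x} {y} a with y ≟ par x | x ≟ par y
  ... | yes e | _ = inj₁ e
  ... | no _ | yes e = inj₂ e
  ... | no ¬p | no ¬q = ⊥-elim (proj₂ isTree (detour-cycle T _≟_ TreeEdge proj₁ (λ { refl → T-irrefl a })
        (λ { (_ , inj₁ e) → ¬p e ; (_ , inj₂ e) → ¬q e }) (T-sym a)
        (climb _ x ≤-refl ◅◅ Star.reverse TreeEdge-sym (climb _ y ≤-refl))))

  Kid : Fin n → Fin n → Set
  Kid v w = w ≢ ρ × par w ≡ v

  adj-kid : ∀ {x y} → Adj T x y → Kid y x ⊎ Kid x y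
  adj-kid {x} {y} a with adj-par a
  ... | inj₁ e = inj₁ ((λ { refl → T-irrefl (subst (Adj T x) (≡.trans e par-ρ) a) }) , sym e)
  ... | inj₂ e = inj₂ ((λ { refl → T-irrefl (subst (λ z → Adj T z y) (≡.trans e par-ρ) a) }) , sym e)

  kid-dep : ∀ {v w} → Kid v w → dep w ≡ suc (dep v)
  kid-dep (w≢ρ , refl) = par-dep w≢ρ

  T-colouring : Colouring T
  T-colouring = (λ x → odd (dep x)) , λ a → odd-↕ (dep-↕ a)
    where
    dep-↕ : ∀ {x y} → Adj T x y → dep x ↕ dep y
    dep-↕ a with adj-kid a
    ... | inj₁ q = inj₂ (kid-dep q)
    ... | inj₂ q = inj₁ (kid-dep q)

  kid? : ∀ v w → Dec (Kid v w)
  kid? v w = ¬? (w ≟ ρ) ×-dec (par w ≟ v)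

  kids : Fin n → List (Fin n)
  kids v = filter (kid? v) (allFin n)

  descend : ℕ → Fin n → List (Fin n)
  nearest : ℕ → List (Fin n) → List (Fin n)
  nearest g [] = []
  nearest g (w ∷ ws) = descend g (argmin (λ u → length (descend g u)) w ws)
  descend zero v = [ v ]
  descend (suc g) v = v ∷ nearest g (kids v)

  -- The path from v down to a closest leaf below v; the fuel d ∸ dep v always reaches it.
  chain : Fin n → List (Fin n)
  chain v = descend (d ∸ dep v) v

  Barren : Fin n → Set
  Barren v = ∀ w → ¬ Kid v w

  data ChainView (v : Fin n) : Set where
    leaf : Barren v → chain v ≡ [ v ] → ChainView v
    next : ∀ w → Kid v w → chain v ≡ v ∷ chain w → (∀ w′ → Kid v w′ → length (chain w) ≤ length (chain w′)) → ChainView v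

  -- Kids of v share one depth, so the fuel passed on is exactly that of each kid's own `chain`, and
  -- `argmin` compares genuine chains. Fuel runs out only at depth d, where a kid would be too deep.
  chain-view : ∀ v → ChainView v
  chain-view v with d ∸ dep v in eq
  ... | zero = leaf (λ w q → <⇒≱ (s≤s (m∸n≡0⇒m≤n {d} eq)) (subst (_≤ d) (kid-dep q) (dist≤d w ρ))) (cong (λ g → descend g v) eq)
  ... | suc g with kids v in kids≡
  ...   | [] = leaf (λ w q → none (subst (w ∈_) kids≡ (∈-filter⁺ (kid? v) (∈-allFin w) q)))
                 (≡.trans (cong (λ g → descend g v) eq) (cong (λ ws → v ∷ nearest g ws) kids≡))
    where none : ∀ {w : Fin n} → w ∉ []
          none ()
  ...   | w ∷ ws = next best (isKid best∈)
                 (≡.trans (cong (λ g → descend g v) eq) (cong (v ∷_) (≡.trans (cong (nearest g) kids≡) (sym (chain≡ (isKid best∈))))))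
                 λ u q → subst (_≤ length (chain u)) (cong length (sym (chain≡ (isKid best∈))))
                   (subst (length (descend g best) ≤_) (cong length (sym (chain≡ q)))
                     (minimal u (subst (u ∈_) kids≡ (∈-filter⁺ (kid? v) (∈-allFin u) q))))
    where
    size : Fin n → ℕ
    size u = length (descend g u)
    best : Fin n
    best = argmin size w ws
    isKid : ∀ {u} → u ∈ w ∷ ws → Kid v u
    isKid u∈ = proj₂ (∈-filter⁻ (kid? v) {xs = allFin n} (subst (_ ∈_) (sym kids≡) u∈))
    best∈ : best ∈ w ∷ ws
    best∈ with argmin-sel size w ws
    ... | inj₁ e = here e
    ... | inj₂ b∈ = there b∈
    minimal : ∀ u → u ∈ w ∷ ws → size best ≤ size u
    minimal u (here refl) = f[argmin]≤f[⊤] {f = size} w ws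
    minimal u (there u∈) = All.lookup (f[argmin]≤f[xs] {f = size} w ws) u∈
    chain≡ : ∀ {u} → Kid v u → chain u ≡ descend g u
    chain≡ {u} q = cong (λ g → descend g u) (≡.trans (cong (d ∸_) (≡.trans (kid-dep q) (+-comm 1 (dep v))))
      (≡.trans (sym (∸-+-assoc d (dep v) 1)) (cong (_∸ 1) eq)))

  module _ (P : Fin n → Set)
           (base : ∀ v → Barren v → chain v ≡ [ v ] → P v)
           (extend : ∀ v w → Kid v w → chain v ≡ v ∷ chain w → P w → P v) where

    chain-induction-fuel : ∀ g v → d ≤ g + dep v → P v
    chain-induction-fuel g v le with chain-view v
    ... | leaf b e = base v b e
    chain-induction-fuel zero v le | next w q e _ =
      ⊥-elim (<⇒≱ (s≤s le) (subst (_≤ d) (kid-dep q) (dist≤d w ρ)))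
    chain-induction-fuel (suc g) v le | next w q e _ =
      extend v w q e (chain-induction-fuel g w (subst (d ≤_) (≡.trans (sym (+-suc g (dep v))) (cong (g +_) (sym (kid-dep q)))) le))

    chain-induction : ∀ v → P v
    chain-induction v = chain-induction-fuel d v (m≤m+n d (dep v))

  -- The path arriving at `par u` goes on to u. The equation of chains makes this decidable; the
  -- vertices failing it, ρ among them, start the paths of the decomposition.
  Continues : Fin n → Set
  Continues u = u ≢ ρ × chain (par u) ≡ par u ∷ chain u

  self∈chain : ∀ v → v ∈ chain v
  self∈chain v with chain-view v
  ... | leaf _ e = subst (v ∈_) (sym e) (here refl)
  ... | next _ _ e _ = subst (v ∈_) (sym e) (here refl)

  ∈-chain : ∀ v u → u ∈ chain v → u ≡ v ⊎ (Continues u × par u ∈ chain v)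
  ∈-chain = chain-induction _ base extend
    where
    base : ∀ v → Barren v → chain v ≡ [ v ] → ∀ u → u ∈ chain v → u ≡ v ⊎ (Continues u × par u ∈ chain v)
    base v _ e u u∈ with subst (u ∈_) e u∈
    ... | here u≡v = inj₁ u≡v
    extend : ∀ v w → Kid v w → chain v ≡ v ∷ chain w → (∀ u → u ∈ chain w → u ≡ w ⊎ (Continues u × par u ∈ chain w)) →
                ∀ u → u ∈ chain v → u ≡ v ⊎ (Continues u × par u ∈ chain v)
    extend v w (w≢ρ , refl) e ih u u∈ with subst (u ∈_) e u∈
    ... | here u≡v = inj₁ u≡v
    ... | there u∈w with ih u u∈w
    ...   | inj₁ refl = inj₂ ((w≢ρ , e) , self∈chain v)
    ...   | inj₂ (c , p) = inj₂ (c , subst (par u ∈_) (sym e) (there p))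

  chain-dep : ∀ v u → u ∈ chain v → dep v ≤ dep u
  chain-dep = chain-induction _ base extend
    where
    base : ∀ v → Barren v → chain v ≡ [ v ] → ∀ u → u ∈ chain v → dep v ≤ dep u
    base v _ e u u∈ with subst (u ∈_) e u∈
    ... | here refl = ≤-refl
    extend : ∀ v w → Kid v w → chain v ≡ v ∷ chain w → (∀ u → u ∈ chain w → dep w ≤ dep u) →
                ∀ u → u ∈ chain v → dep v ≤ dep u
    extend v w q e ih u u∈ with subst (u ∈_) e u∈
    ... | here refl = ≤-refl
    ... | there u∈w = ≤-trans (≤-trans (n≤1+n _) (≤-reflexive (sym (kid-dep q)))) (ih u u∈w)

  chain-unique : ∀ v → Unique (chain v)
  chain-unique = chain-induction _ (λ v _ e → subst Unique (sym e) ([] ∷ []))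
    λ v w q e ih → subst Unique (sym e) (All.¬Any⇒All¬ _
      (λ v∈ → <⇒≱ (≤-reflexive (sym (kid-dep q))) (chain-dep w v v∈)) ∷ ih)

  -- While u heads neither chain, its parent lies in both; climbing must therefore reach one of the
  -- heads inside the other chain.
  comparable : ∀ g u v w → dep u ≤ g → u ∈ chain v → u ∈ chain w → v ∈ chain w ⊎ w ∈ chain v
  comparable g u v w le u∈v u∈w with ∈-chain v u u∈v | ∈-chain w u u∈w
  ... | inj₁ refl | _ = inj₁ u∈w
  ... | inj₂ _ | inj₁ refl = inj₂ u∈v
  comparable zero u v w le u∈v u∈w | inj₂ ((u≢ρ , _) , _) | inj₂ _ =
    ⊥-elim (<⇒≱ (subst (0 <_) (sym (par-dep u≢ρ)) (s≤s z≤n)) le)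
  comparable (suc g) u v w le u∈v u∈w | inj₂ ((u≢ρ , _) , p) | inj₂ (_ , q) =
    comparable g (par u) v w (s≤s⁻¹ (subst (_≤ suc g) (par-dep u≢ρ) le)) p q

  siblings-incomparable : ∀ {p v w} → Kid p v → Kid p w → v ∈ chain w → v ≡ w
  siblings-incomparable {p} {v} {w} (_ , refl) qw v∈ with ∈-chain w v v∈
  ... | inj₁ e = e
  ... | inj₂ (_ , p∈) = ⊥-elim (<⇒≱ (≤-reflexive (sym (kid-dep qw))) (chain-dep w p p∈))

  siblings-disjoint : ∀ {p v w u} → Kid p v → Kid p w → u ∈ chain v → u ∈ chain w → v ≡ w
  siblings-disjoint {p} {v} {w} {u} qv qw u∈v u∈w with comparable _ u v w ≤-refl u∈v u∈w
  ... | inj₁ v∈ = siblings-incomparable qv qw v∈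
  ... | inj₂ w∈ = sym (siblings-incomparable qw qv w∈)

  -- Measured from `par v`, so that the number of vertices in the chain is the length of the walk
  -- and the walks of two siblings share an end.
  LeafBelow : Fin n → Set
  LeafBelow v = v ≢ ρ → ∃ λ ℓ → ℓ ∈ chain v × IsLeaf T ℓ × ℓ ≢ ρ × Walk T (par v) ℓ (length (chain v))

  leaf-below : ∀ v → LeafBelow v
  leaf-below = chain-induction LeafBelow base extend
    where
    base : ∀ v → Barren v → chain v ≡ [ v ] → LeafBelow v
    base v b e v≢ρ = v , self∈chain v , (par v , par-adj v≢ρ , only) , v≢ρ ,
      subst (λ c → Walk T (par v) v (length c)) (sym e) (step (T-sym (par-adj v≢ρ)) here)
      where
      only : ∀ z → Adj T v z → z ≡ par v
      only z a with adj-kid a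
      ... | inj₁ (_ , e) = sym e
      ... | inj₂ q = ⊥-elim (b z q)
    extend : ∀ v w → Kid v w → chain v ≡ v ∷ chain w → LeafBelow w → LeafBelow v
    extend v w (w≢ρ , refl) e ih v≢ρ with ih w≢ρ
    ... | ℓ , ℓ∈ , isLeaf , ℓ≢ρ , walk = ℓ , subst (ℓ ∈_) (sym e) (there ℓ∈) , isLeaf , ℓ≢ρ ,
          subst (λ c → Walk T (par v) ℓ (length c)) (sym e) (step (T-sym (par-adj v≢ρ)) walk)

  k≤walk : ∀ {x y l} → IsLeaf T x → IsLeaf T y → x ≢ y → Walk T x y l → k ≤ l
  k≤walk {x} {y} lx ly x≢y w = ≤-trans (proj₂ spread x y _ lx ly x≢y (isDist x y)) (proj₂ (isDist x y) _ w)

  -- The leaf below v and the nearer leaf below the preferred sibling of v are at distance at least k.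
  top-long : ∀ {v} → v ≢ ρ → ¬ Continues v → k ≤ 2 * length (chain v)
  top-long {v} v≢ρ top with chain-view (par v)
  ... | leaf b _ = ⊥-elim (b v (v≢ρ , refl))
  ... | next w q@(w≢ρ , par≡) e min with leaf-below v v≢ρ | leaf-below w w≢ρ
  ...   | ℓ , ℓ∈ , isLeaf , _ , walk | ℓ′ , ℓ′∈ , isLeaf′ , _ , walk′ =
    ≤-trans (k≤walk isLeaf isLeaf′ ℓ≢ℓ′
      (walk-++ T (walk-sym T T-sym walk) (subst (λ p → Walk T p ℓ′ (length (chain w))) par≡ walk′)))
      (+-monoʳ-≤ (length (chain v)) (≤-trans (min v (v≢ρ , refl)) (≤-reflexive (sym (+-identityʳ _)))))
    where
    ℓ≢ℓ′ : ℓ ≢ ℓ′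
    ℓ≢ℓ′ refl with siblings-disjoint (v≢ρ , refl) q ℓ∈ ℓ′∈
    ... | refl = top (v≢ρ , e)

  -- The walk from ρ to the leaf at the bottom already joins two leaves, so no factor 2 is lost.
  root-long : ∃ λ w → Kid ρ w × chain ρ ≡ ρ ∷ chain w × k ≤ length (chain w)
  root-long with chain-view ρ
  ... | leaf b _ with ρ-leaf
  ...   | y , a , _ with adj-kid a
  ...     | inj₁ (ρ≢ρ , _) = ⊥-elim (ρ≢ρ refl)
  ...     | inj₂ q = ⊥-elim (b y q)
  root-long | next w q@(w≢ρ , par≡) e _ with leaf-below w w≢ρ
  ...   | ℓ , _ , isLeaf , ℓ≢ρ , walk =
    w , q , e , k≤walk ρ-leaf isLeaf (ℓ≢ρ ∘ sym) (subst (λ p → Walk T p ℓ (length (chain w))) par≡ walk)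

-- Subdivisions

track-walk : ∀ G (f : ℕ → V G) s → (∀ j → j < s → Adj G (f j) (f (suc j))) → ∀ i l → i + l ≤ s → Walk G (f i) (f (i + l)) l
track-walk G f s adj i zero le = subst (λ j → Walk G (f i) (f j) 0) (sym (+-identityʳ i)) here
track-walk G f s adj i (suc l) le =
  step (adj i (≤-trans (s≤s (m≤m+n i l)) (subst (_≤ s) (+-suc i l) le)))
       (subst (λ j → Walk G (f (suc i)) (f j) l) (sym (+-suc i l)) (track-walk G f s adj (suc i) l (subst (_≤ s) (+-suc i l) le)))

SubV-≟ : ∀ {n m s} → DecidableEquality (SubV n m s)
SubV-≟ (orig v) (orig w) = map′ (cong orig) (λ { refl → refl }) (v ≟ w)
SubV-≟ (orig v) (mid f j) = no λ ()
SubV-≟ (mid e i) (orig w) = no λ ()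
SubV-≟ (mid e i) (mid f j) = map′ (λ { (refl , refl) → refl }) (λ { refl → refl , refl }) (e ≟ f ×-dec i ≟ j)

-- For the four distances between the endpoints of two edges of T: the two routes in T′ through
-- the equal pair have total length at most 2sd, so one of them has length at most sd.
diagonal : ∀ {a b c e d} → a ↕ b → a ↕ c → b ↕ e → c ↕ e → a ≤ d → b ≤ d → c ≤ d → e ≤ d →
           (a ≡ e × suc a ≤ d) ⊎ (b ≡ c × suc b ≤ d)
diagonal (inj₁ refl) (inj₁ refl) (inj₂ refl) _ _ b≤ _ _ = inj₁ (refl , b≤)
diagonal (inj₁ refl) (inj₁ refl) (inj₁ refl) _ _ _ _ e≤ = inj₂ (refl , e≤)
diagonal (inj₁ refl) (inj₂ refl) (inj₂ refl) _ _ b≤ _ _ = inj₁ (refl , b≤)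
diagonal (inj₁ refl) (inj₂ refl) (inj₁ refl) (inj₁ ())
diagonal (inj₁ refl) (inj₂ refl) (inj₁ refl) (inj₂ ())
diagonal (inj₂ refl) (inj₁ refl) _ (inj₂ refl) _ _ c≤ _ = inj₁ (refl , c≤)
diagonal (inj₂ refl) (inj₁ refl) (inj₁ ()) (inj₁ refl)
diagonal (inj₂ refl) (inj₁ refl) (inj₂ ()) (inj₁ refl)
diagonal (inj₂ refl) (inj₂ refl) _ _ a≤ _ _ _ = inj₂ (refl , a≤)

module Subdivided {n m : ℕ} (ends : Fin m → Fin n × Fin n) (simple : SimpleEdges ends) (isTree : IsTree (EdgeGraph ends))
                  (k d : ℕ) (spread : HasSpread (EdgeGraph ends) k) (diameter : HasDiameter (EdgeGraph ends) d)
                  (s′ : ℕ) where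
  open Tree ends simple isTree k d spread diameter

  s : ℕ
  s = suc s′

  T′ : Graph
  T′ = Subdivision ends s

  at : Fin m → ℕ → V T′
  at = pos ends s

  at-mid : ∀ e {j} (p : j < s′) → at e (suc j) ≡ mid e (fromℕ< p)
  at-mid e {j} p with j <? s′
  ... | yes _ = refl
  ... | no ¬p = ⊥-elim (¬p p)

  at-end : ∀ e → at e s ≡ orig (proj₂ (ends e))
  at-end e with s′ <? s′
  ... | yes p = ⊥-elim (<-irrefl refl p)
  ... | no _ = refl

  T′-sym : Symmetric (Adj T′)
  T′-sym (e , j , j<s , inj₁ p) = e , j , j<s , inj₂ p
  T′-sym (e , j , j<s , inj₂ p) = e , j , j<s , inj₁ p

  at-adj : ∀ e {j} → j < s → Adj T′ (at e j) (at e (suc j))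
  at-adj e j<s = e , _ , j<s , inj₁ (refl , refl)

  -- The vertices of the subdivided edge below par w, listed from par w to w.
  track : ∀ {w} → Adj T w (par w) → ℕ → V T′
  track (e , inj₁ _) j = at e (s ∸ j)
  track (e , inj₂ _) j = at e j

  track-top : ∀ {w} (a : Adj T w (par w)) → track a 0 ≡ orig (par w)
  track-top (e , inj₁ p) = ≡.trans (at-end e) (cong (λ z → orig (proj₂ z)) p)
  track-top (e , inj₂ p) = cong (λ z → orig (proj₁ z)) p

  track-bottom : ∀ {w} (a : Adj T w (par w)) → track a s ≡ orig w
  track-bottom (e , inj₁ p) = ≡.trans (cong (at e) (n∸n≡0 s)) (cong (λ z → orig (proj₁ z)) p)
  track-bottom (e , inj₂ p) = ≡.trans (at-end e) (cong (λ z → orig (proj₂ z)) p)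

  suc-∸-suc : ∀ {m n} → n < m → m ∸ n ≡ suc (m ∸ suc n)
  suc-∸-suc {m} {n} n<m = +-∸-assoc 1 n<m

  track-adj : ∀ {w} (a : Adj T w (par w)) {j} → j < s → Adj T′ (track a j) (track a (suc j))
  track-adj (e , inj₂ _) j<s = at-adj e j<s
  track-adj (e , inj₁ _) {j} j<s = T′-sym (subst (λ i → Adj T′ (at e (s ∸ suc j)) (at e i)) (sym (suc-∸-suc j<s))
    (at-adj e (s≤s (m∸n≤m s′ j))))

  lower : Fin m → Fin n
  lower e with proj₂ (ends e) ≟ par (proj₁ (ends e))
  ... | yes _ = proj₁ (ends e)
  ... | no _  = proj₂ (ends e)

  -- The subdivided edge above w is assigned to w without its top vertex; with the root on its own,
  -- these half-open pieces partition T′.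
  owner : V T′ → Fin n
  owner (orig v) = v
  owner (mid e i) = lower e

  -- Height below `orig ρ`, which yields the bipartition and separates upper from lower neighbours.
  -- Since `mid e i` sits at position i + 1, it is `s′ ∸ toℕ i` steps from the second end.
  depth : V T′ → ℕ
  depth (orig v) = dep v * s
  depth (mid e i) with proj₂ (ends e) ≟ par (proj₁ (ends e))
  ... | yes _ = dep (proj₂ (ends e)) * s + (s′ ∸ toℕ i)
  ... | no _  = dep (proj₁ (ends e)) * s + suc (toℕ i)

  Located : Fin n → ℕ → V T′ → Set
  Located w j x = owner x ≡ w × depth x ≡ dep (par w) * s + j

  -- Keeps the test in `lower` and `depth` from succeeding on an edge listed as (par w , w), where
  -- it would take the parent for the lower end.
  par-no-return : ∀ {w} → w ≢ ρ → w ≢ par (par w)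
  par-no-return {w} w≢ρ e with par w ≟ ρ
  ... | yes p≡ρ = w≢ρ (≡.trans e (≡.trans (cong par p≡ρ) par-ρ))
  ... | no p≢ρ = <⇒≱ (≤-refl {suc (dep w)}) (≤-trans (s≤s (≤-trans (≤-reflexive (cong dep e)) (n≤1+n _)))
                   (≤-trans (s≤s (≤-reflexive (sym (par-dep p≢ρ)))) (≤-reflexive (sym (par-dep w≢ρ)))))

  mid-down : ∀ {w} e i → w ≢ ρ → ends e ≡ (par w , w) → Located w (suc (toℕ i)) (mid e i)
  mid-down {w} e i w≢ρ p with proj₂ (ends e) ≟ par (proj₁ (ends e))
  ... | yes q = ⊥-elim (par-no-return w≢ρ (subst (λ z → proj₂ z ≡ par (proj₁ z)) p q))
  ... | no _ = cong proj₂ p , cong (λ z → dep (proj₁ z) * s + suc (toℕ i)) p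

  mid-up : ∀ {w} e i → ends e ≡ (w , par w) → Located w (s′ ∸ toℕ i) (mid e i)
  mid-up {w} e i p with proj₂ (ends e) ≟ par (proj₁ (ends e))
  ... | yes _ = cong proj₁ p , cong (λ z → dep (proj₂ z) * s + (s′ ∸ toℕ i)) p
  ... | no ¬q = ⊥-elim (¬q (≡.trans (cong proj₂ p) (cong (λ z → par (proj₁ z)) (sym p))))

  orig-located : ∀ {w} → w ≢ ρ → Located w s (orig w)
  orig-located {w} w≢ρ = refl , ≡.trans (cong (_* s) (par-dep w≢ρ)) (+-comm s (dep (par w) * s))

  track-located : ∀ {w} → w ≢ ρ → (a : Adj T w (par w)) → ∀ {j} → j < s → Located w (suc j) (track a (suc j))
  track-located {w} w≢ρ a {j} j<s with m≤n⇒m<n∨m≡n (s≤s⁻¹ j<s)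
  ... | inj₂ refl = subst (Located w s) (sym (track-bottom a)) (orig-located w≢ρ)
  track-located {w} w≢ρ (e , inj₂ p) {j} j<s | inj₁ j<s′ =
    subst (Located w (suc j)) (sym (at-mid e j<s′))
      (subst (λ i → Located w (suc i) (mid e (fromℕ< j<s′))) (toℕ-fromℕ< j<s′) (mid-down e (fromℕ< j<s′) w≢ρ p))
  track-located {w} w≢ρ (e , inj₁ p) {j} j<s | inj₁ j<s′ =
    subst (Located w (suc j)) (sym (≡.trans (cong (at e) (suc-∸-suc j<s′)) (at-mid e i<s′)))
      (subst (λ i → Located w i (mid e (fromℕ< i<s′)))
        (≡.trans (cong (s′ ∸_) (toℕ-fromℕ< i<s′)) (m∸[m∸n]≡n j<s′)) (mid-up e (fromℕ< i<s′) p))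
    where
    i<s′ : s′ ∸ suc j < s′
    i<s′ = ∸-monoʳ-< (s≤s z≤n) j<s′

  abstract
    -- A coordinate from 0 at `par w` to s at w, whichever way the edge is listed; `orig ρ` is a
    -- default for the root, which has no edge above it.
    place : Fin n → ℕ → V T′
    place w j with w ≟ ρ
    ... | yes _ = orig ρ
    ... | no w≢ρ = track (par-adj w≢ρ) j

    place-track : ∀ {w} → w ≢ ρ → Σ (Adj T w (par w)) λ a → ∀ j → place w j ≡ track a j
    place-track {w} w≢ρ with w ≟ ρ
    ... | yes w≡ρ = ⊥-elim (w≢ρ w≡ρ)
    ... | no w≢ρ′ = par-adj w≢ρ′ , λ _ → refl

  place-top : ∀ {w} → w ≢ ρ → place w 0 ≡ orig (par w)
  place-top w≢ρ = let a , e = place-track w≢ρ in ≡.trans (e 0) (track-top a)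

  place-bottom : ∀ {w} → w ≢ ρ → place w s ≡ orig w
  place-bottom w≢ρ = let a , e = place-track w≢ρ in ≡.trans (e s) (track-bottom a)

  place-adj : ∀ {w} → w ≢ ρ → ∀ {j} → j < s → Adj T′ (place w j) (place w (suc j))
  place-adj w≢ρ {j} j<s = let a , e = place-track w≢ρ in
    subst₂ (Adj T′) (sym (e j)) (sym (e (suc j))) (track-adj a j<s)

  place-located : ∀ {w} → w ≢ ρ → ∀ {j} → j < s → Located w (suc j) (place w (suc j))
  place-located {w} w≢ρ {j} j<s = let a , e = place-track w≢ρ in
    subst (Located w (suc j)) (sym (e (suc j))) (track-located w≢ρ a j<s)

  place-depth : ∀ {w} → w ≢ ρ → ∀ {j} → j ≤ s → depth (place w j) ≡ dep (par w) * s + j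
  place-depth w≢ρ {zero} _ = ≡.trans (cong depth (place-top w≢ρ)) (sym (+-identityʳ _))
  place-depth w≢ρ {suc j} j<s = proj₂ (place-located w≢ρ j<s)

  -- `place` uses some edge between w and its parent; `SimpleEdges` identifies it with e, and
  -- conflicting orientations would make e a loop.
  edge-place : ∀ e → ∃ λ w → w ≢ ρ × ((∀ j → j ≤ s → at e j ≡ place w j) ⊎ (∀ j → j ≤ s → at e j ≡ place w (s ∸ j)))
  edge-place e with adj-kid {proj₁ (ends e)} {proj₂ (ends e)} (e , inj₁ refl)
  ... | inj₁ (w≢ρ , p) = _ , w≢ρ , inj₂ same
    where
    same : ∀ j → j ≤ s → at e j ≡ place (proj₁ (ends e)) (s ∸ j)
    same j j≤s with place-track w≢ρ
    ... | (e′ , inj₁ q) , eq rewrite proj₂ simple e e′ (inj₁ (≡.trans (cong (proj₁ (ends e) ,_) (sym p)) (sym q))) =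
      ≡.trans (cong (at e′) (sym (m∸[m∸n]≡n j≤s))) (sym (eq (s ∸ j)))
    ... | (e′ , inj₂ q) , eq with proj₂ simple e e′ (inj₂ (≡.trans (cong (proj₁ (ends e) ,_) (sym p))
                                    (sym (cong₂ _,_ (cong proj₂ q) (cong proj₁ q)))))
    ...   | refl = ⊥-elim (proj₁ simple e (≡.trans (cong proj₁ q) p))
  ... | inj₂ (w≢ρ , p) = _ , w≢ρ , inj₁ same
    where
    same : ∀ j → j ≤ s → at e j ≡ place (proj₂ (ends e)) j
    same j j≤s with place-track w≢ρ
    ... | (e′ , inj₂ q) , eq rewrite proj₂ simple e e′ (inj₁ (≡.trans (cong (_, proj₂ (ends e)) (sym p)) (sym q))) = sym (eq j)
    ... | (e′ , inj₁ q) , eq with proj₂ simple e e′ (inj₂ (≡.trans (cong (_, proj₂ (ends e)) (sym p))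
                                    (sym (cong₂ _,_ (cong proj₂ q) (cong proj₁ q)))))
    ...   | refl = ⊥-elim (proj₁ simple e (≡.trans (sym p) (sym (cong proj₂ q))))

  data Steps (x y : V T′) : Set where
    down : ∀ w j → w ≢ ρ → j < s → x ≡ place w j → y ≡ place w (suc j) → Steps x y
    up   : ∀ w j → w ≢ ρ → j < s → y ≡ place w j → x ≡ place w (suc j) → Steps x y

  steps-sym : ∀ {x y} → Steps x y → Steps y x
  steps-sym (down w j a b p q) = up w j a b p q
  steps-sym (up w j a b p q) = down w j a b p q

  adj-steps : ∀ {x y} → Adj T′ x y → Steps x y
  adj-steps (e , j , j<s , inj₁ (refl , refl)) with edge-place e
  ... | w , w≢ρ , inj₁ eq = down w j w≢ρ j<s (eq j (<⇒≤ j<s)) (eq (suc j) j<s)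
  ... | w , w≢ρ , inj₂ eq = up w (s′ ∸ j) w≢ρ (s≤s (m∸n≤m s′ j)) (eq (suc j) j<s)
        (≡.trans (eq j (<⇒≤ j<s)) (cong (place w) (suc-∸-suc j<s)))
  adj-steps (e , j , j<s , inj₂ (refl , refl)) = steps-sym (adj-steps (e , j , j<s , inj₁ (refl , refl)))

  down-depth : ∀ {w j x y} → w ≢ ρ → j < s → x ≡ place w j → y ≡ place w (suc j) → depth y ≡ suc (depth x)
  down-depth {w} {j} w≢ρ j<s refl refl = ≡.trans (place-depth w≢ρ j<s)
    (≡.trans (+-suc _ j) (cong suc (sym (place-depth w≢ρ (<⇒≤ j<s)))))

  depth-↕ : ∀ {x y} → Adj T′ x y → depth x ↕ depth y
  depth-↕ a with adj-steps a
  ... | down w j w≢ρ j<s p q = inj₁ (down-depth w≢ρ j<s p q)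
  ... | up w j w≢ρ j<s p q = inj₂ (down-depth w≢ρ j<s p q)

  T′-colouring : Colouring T′
  T′-colouring = (λ x → odd (depth x)) , λ a → odd-↕ (depth-↕ a)

  T′-irrefl : ∀ {x} → ¬ Adj T′ x x
  T′-irrefl a with depth-↕ a
  ... | inj₁ e = 1+n≢n (sym e)
  ... | inj₂ e = 1+n≢n (sym e)

  upper-place : ∀ {x y} → Adj T′ x y → depth y ≡ suc (depth x) →
                ∃ λ j → x ≡ place (owner y) j × depth y ≡ dep (par (owner y)) * s + suc j
  upper-place a e with adj-steps a
  ... | up w j w≢ρ j<s p q = ⊥-elim (m≢1+m+n _ {1} (≡.trans e (cong suc (≡.trans (down-depth w≢ρ j<s p q) (+-comm 1 _)))))
  ... | down w j w≢ρ j<s p refl with place-located w≢ρ j<s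
  ...   | o , dy = j , ≡.trans p (cong (λ u → place u j) (sym o)) ,
                   ≡.trans dy (cong (λ u → dep (par u) * s + suc j) (sym o))

  -- A neighbour above y lies on the edge assigned to the owner of y, and the depth of y fixes its
  -- coordinate there.
  upper-unique : ∀ {x x′ y} → Adj T′ x y → Adj T′ x′ y → depth y ≡ suc (depth x) → depth y ≡ suc (depth x′) → x ≡ x′
  upper-unique a a′ e e′ with upper-place a e | upper-place a′ e′
  ... | j , refl , q | j′ , refl , q′ = cong (place _) (suc-injective (+-cancelˡ-≡ _ _ _ (≡.trans (sym q) q′)))

  -- A deepest vertex of a square would have both its neighbours above it, and these coincide by
  -- `upper-unique`: either x = z, or y = t and t lies on P. The other sign patterns move three
  -- steps in one direction and cannot close.
  no-square : ∀ P → NoSquare T′ P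
  no-square P t x y z t∉ _ y∈ _ xy yz x≢z xt zt with depth-↕ xy | depth-↕ yz | depth-↕ xt | depth-↕ zt
  ... | inj₁ a | inj₂ b | _ | _ = x≢z (upper-unique xy (T′-sym yz) a b)
  ... | _ | inj₁ b | _ | inj₂ c = t∉ (subst (_∈ P) (upper-unique yz (T′-sym zt) b c) y∈)
  ... | inj₁ a | inj₁ b | inj₁ c | inj₁ e = ⊥-elim (skip a b e c)
    where skip : ∀ {p q r u} → q ≡ suc p → r ≡ suc q → u ≡ suc r → u ≢ suc p
          skip refl refl refl ()
  ... | inj₁ a | inj₁ b | inj₂ c | inj₁ e = ⊥-elim (skip a b e c)
    where skip : ∀ {p q r u} → q ≡ suc p → r ≡ suc q → u ≡ suc r → p ≢ suc u
          skip refl refl refl ()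
  ... | inj₂ a | _ | inj₂ c | _ = t∉ (subst (_∈ P) (upper-unique (T′-sym xy) (T′-sym xt) a c) y∈)
  ... | inj₂ a | _ | inj₁ c | inj₁ e = x≢z (upper-unique xt zt c e)
  ... | inj₂ a | inj₂ b | inj₁ c | inj₂ e = ⊥-elim (skip a c e b)
    where skip : ∀ {p q r u} → p ≡ suc q → r ≡ suc p → u ≡ suc r → q ≢ suc u
          skip refl refl refl ()

  mid-at : ∀ e i → mid e i ≡ at e (suc (toℕ i))
  mid-at e i = sym (≡.trans (at-mid e (toℕ<n i)) (cong (mid e) (fromℕ<-toℕ i (toℕ<n i))))

  located-place : ∀ x → owner x ≢ ρ → ∃ λ j → j < s × x ≡ place (owner x) (suc j)
  located-place (orig v) v≢ρ = s′ , ≤-refl , sym (place-bottom v≢ρ)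
  located-place (mid e i) _ = from-edge (edge-place e)
    where
    locate : ∀ {w j} → w ≢ ρ → j < s → mid e i ≡ place w (suc j) → ∃ λ j → j < s × mid e i ≡ place (lower e) (suc j)
    locate {j = j} w≢ρ j<s p = j , j<s ,
      ≡.trans p (cong (λ u → place u (suc j)) (sym (≡.trans (cong owner p) (proj₁ (place-located w≢ρ j<s)))))
    i<s : toℕ i < s
    i<s = m<n⇒m<1+n (toℕ<n i)
    from-edge : (∃ λ w → w ≢ ρ × ((∀ j → j ≤ s → at e j ≡ place w j) ⊎ (∀ j → j ≤ s → at e j ≡ place w (s ∸ j)))) →
                ∃ λ j → j < s × mid e i ≡ place (lower e) (suc j)
    from-edge (w , w≢ρ , inj₁ eq) = locate w≢ρ i<s (≡.trans (mid-at e i) (eq (suc (toℕ i)) i<s))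
    from-edge (w , w≢ρ , inj₂ eq) = locate w≢ρ (s≤s (m∸n≤m s′ (suc (toℕ i))))
      (≡.trans (mid-at e i) (≡.trans (eq (suc (toℕ i)) i<s) (cong (place w) (suc-∸-suc (toℕ<n i)))))

  owner-mid≢ρ : ∀ e i → owner (mid e i) ≢ ρ
  owner-mid≢ρ e i q with adj-kid {proj₁ (ends e)} {proj₂ (ends e)} (e , inj₁ refl)
  ... | inj₁ (w≢ρ , p) = w≢ρ (≡.trans (sym (proj₁ (mid-up {proj₁ (ends e)} e i (cong (proj₁ (ends e) ,_) (sym p))))) q)
  ... | inj₂ (w≢ρ , p) = w≢ρ (≡.trans (sym (proj₁ (mid-down {proj₂ (ends e)} e i w≢ρ (cong (_, proj₂ (ends e)) (sym p))))) q)

  on-edge : ∀ x → ∃ λ w → w ≢ ρ × ∃ λ j → j ≤ s × x ≡ place w j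
  on-edge x with owner x ≟ ρ
  ... | no ≢ρ = let j , j<s , e = located-place x ≢ρ in owner x , ≢ρ , suc j , j<s , e
  on-edge (mid e i) | yes q = ⊥-elim (owner-mid≢ρ e i q)
  -- The root is found at the top of its kid's edge.
  on-edge (orig v) | yes refl with root-long
  ... | w , (w≢ρ , p) , _ = w , w≢ρ , 0 , z≤n , sym (≡.trans (place-top w≢ρ) (cong orig p))

  -- Distances in the subdivided tree

  walk-to-top : ∀ {w} → w ≢ ρ → ∀ {j} → j ≤ s → Walk T′ (place w j) (orig (par w)) j
  walk-to-top {w} w≢ρ {j} j≤s = walk-sym T′ T′-sym (subst (λ x → Walk T′ x (place w j) j) (place-top w≢ρ)
    (track-walk T′ (place w) s (λ _ → place-adj w≢ρ) 0 j j≤s))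

  walk-to-bottom : ∀ {w} → w ≢ ρ → ∀ {j} → j ≤ s → Walk T′ (place w j) (orig w) (s ∸ j)
  walk-to-bottom {w} w≢ρ {j} j≤s = subst (λ x → Walk T′ (place w j) x (s ∸ j))
    (≡.trans (cong (place w) (m+[n∸m]≡n j≤s)) (place-bottom w≢ρ))
    (track-walk T′ (place w) s (λ _ → place-adj w≢ρ) j (s ∸ j) (≤-reflexive (m+[n∸m]≡n j≤s)))

  kid-walk : ∀ {v w} → Kid v w → Walk T′ (orig w) (orig v) s
  kid-walk {w = w} (w≢ρ , refl) = subst (λ x → Walk T′ x (orig (par w)) s) (place-bottom w≢ρ) (walk-to-top w≢ρ ≤-refl)

  lift-walk : ∀ {x y l} → Walk T x y l → Walk T′ (orig x) (orig y) (l * s)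
  lift-walk here = here
  lift-walk (step a w) with adj-kid a
  ... | inj₁ q = walk-++ T′ (kid-walk q) (lift-walk w)
  ... | inj₂ q = walk-++ T′ (walk-sym T′ T′-sym (kid-walk q)) (lift-walk w)

  dist-sym : ∀ x y → dist x y ≡ dist y x
  dist-sym x y = ≤-antisym (proj₂ (isDist x y) _ (walk-sym T T-sym (proj₁ (isDist y x))))
                           (proj₂ (isDist y x) _ (walk-sym T T-sym (proj₁ (isDist x y))))

  ↕ˡ : ∀ {x y} t → Adj T x y → dist x t ↕ dist y t
  ↕ˡ t = dist-↕ T T-colouring T-metric t

  ↕ʳ : ∀ {x y} t → Adj T x y → dist t x ↕ dist t y
  ↕ʳ {x} {y} t a = subst₂ _↕_ (dist-sym x t) (dist-sym y t) (↕ˡ t a)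

  -- For either pairing of opposite ends, the end pieces of the two matching routes total 2s, so one
  -- route spends at most s on them. `diagonal` picks a pairing with equal distances below d, so the
  -- rest costs at most s(d - 1).
  short-walk : ∀ x y → ∃ λ l → l ≤ s * d × Walk T′ x y l
  short-walk x y with on-edge x | on-edge y
  ... | v , v≢ρ , i , i≤s , refl | w , w≢ρ , j , j≤s , refl =
    choose (diagonal (↕ʳ (par v) (up-adj w≢ρ)) (↕ˡ (par w) (up-adj v≢ρ)) (↕ˡ w (up-adj v≢ρ)) (↕ʳ v (up-adj w≢ρ))
      (dist≤d _ _) (dist≤d _ _) (dist≤d _ _) (dist≤d _ _))
    where
    up-adj : ∀ {u} → u ≢ ρ → Adj T (par u) u
    up-adj u≢ρ = T-sym (par-adj u≢ρ)
    via : ∀ {a b p q l} → Walk T′ (place v i) (orig a) p → Walk T a b l → Walk T′ (place w j) (orig b) q →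
          p + q ≤ s → suc l ≤ d → ∃ λ l → l ≤ s * d × Walk T′ (place v i) (place w j) l
    via {p = p} {q} {l} W₁ W₂ W₃ pq l<d = p + (l * s + q) , bound ,
      walk-++ T′ W₁ (walk-++ T′ (lift-walk W₂) (walk-sym T′ T′-sym W₃))
      where
      open +-*-Solver
      bound : p + (l * s + q) ≤ s * d
      bound = ≤-trans (≤-reflexive (solve 3 (λ p x q → p :+ (x :+ q) := p :+ q :+ x) refl p (l * s) q))
        (≤-trans (+-monoˡ-≤ (l * s) pq) (≤-trans (*-monoˡ-≤ s l<d) (≤-reflexive (*-comm d s))))
    choose : (dist (par v) (par w) ≡ dist v w × suc (dist (par v) (par w)) ≤ d) ⊎
             (dist (par v) w ≡ dist v (par w) × suc (dist (par v) w) ≤ d) →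
             ∃ λ l → l ≤ s * d × Walk T′ (place v i) (place w j) l
    choose (inj₁ (eq , le)) with ≤-total (i + j) s
    ... | inj₁ ij≤s = via (walk-to-top v≢ρ i≤s) (proj₁ (isDist _ _)) (walk-to-top w≢ρ j≤s) ij≤s le
    ... | inj₂ s≤ij = via (walk-to-bottom v≢ρ i≤s) (proj₁ (isDist _ _)) (walk-to-bottom w≢ρ j≤s)
          (≤-trans (+-monoˡ-≤ (s ∸ j) (m≤n+o⇒m∸n≤o s i s≤ij)) (≤-reflexive (m+[n∸m]≡n j≤s))) (subst (λ z → suc z ≤ d) eq le)
    choose (inj₂ (eq , le)) with ≤-total i j
    ... | inj₁ i≤j = via (walk-to-top v≢ρ i≤s) (proj₁ (isDist _ _)) (walk-to-bottom w≢ρ j≤s)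
          (≤-trans (+-monoˡ-≤ (s ∸ j) i≤j) (≤-reflexive (m+[n∸m]≡n j≤s))) le
    ... | inj₂ j≤i = via (walk-to-bottom v≢ρ i≤s) (proj₁ (isDist _ _)) (walk-to-top w≢ρ j≤s)
          (≤-trans (+-monoʳ-≤ (s ∸ i) j≤i) (≤-reflexive (m∸n+n≡m i≤s))) (subst (λ z → suc z ≤ d) eq le)

  T′-adj? : Decidable₂ (Adj T′)
  T′-adj? x y = any? λ e → anyUpTo? (λ j → (SubV-≟ x (at e j) ×-dec SubV-≟ y (at e (suc j)))
                                    ⊎-dec (SubV-≟ y (at e j) ×-dec SubV-≟ x (at e (suc j)))) s

  T′-vertices : List (V T′)
  T′-vertices = map orig (allFin n) ++ cartesianProductWith mid (allFin m) (allFin s′)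

  T′-complete : ∀ x → x ∈ T′-vertices
  T′-complete (orig v) = ∈-++⁺ˡ (∈-map⁺ orig (∈-allFin v))
  T′-complete (mid e i) = ∈-++⁺ʳ (map orig (allFin n)) (∈-cartesianProductWith⁺ mid (∈-allFin e) (∈-allFin i))

  T′-metric : Metric T′
  T′-metric = finiteMetric T′ SubV-≟ T′-adj? T′-vertices T′-complete T′-sym
    (λ x y → let l , _ , w = short-walk x y in l , w)

  T′-bounded : ∀ x y → Metric.dist T′-metric x y ≤ s * d
  T′-bounded x y = let l , l≤ , w = short-walk x y in ≤-trans (proj₂ (Metric.isDist T′-metric x y) l w) l≤

  -- Threads: the path decomposition of the subdivided tree

  block : Fin n → List (V T′)
  block w with w ≟ ρ
  ... | yes _ = [ orig ρ ]
  ... | no _ = applyUpTo (λ j → place w (suc j)) s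

  block-ρ : block ρ ≡ [ orig ρ ]
  block-ρ with ρ ≟ ρ
  ... | yes _ = refl
  ... | no ρ≢ρ = ⊥-elim (ρ≢ρ refl)

  block≡ : ∀ {w} → w ≢ ρ → block w ≡ applyUpTo (λ j → place w (suc j)) s
  block≡ {w} w≢ρ with w ≟ ρ
  ... | yes w≡ρ = ⊥-elim (w≢ρ w≡ρ)
  ... | no _ = refl

  block-owner : ∀ w {x} → x ∈ block w → owner x ≡ w
  block-owner w {x} x∈ with w ≟ ρ
  block-owner w (here refl) | yes w≡ρ = sym w≡ρ
  ... | no w≢ρ with ∈-applyUpTo⁻ (λ j → place w (suc j)) x∈
  ...   | j , j<s , refl = proj₁ (place-located w≢ρ j<s)

  ∈-block : ∀ x → x ∈ block (owner x)
  ∈-block x = go (owner x ≟ ρ) x refl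
    where
    go : ∀ {w} → Dec (w ≡ ρ) → ∀ x → owner x ≡ w → x ∈ block w
    go (no w≢ρ) x refl with located-place x w≢ρ
    ... | j , j<s , e = subst (x ∈_) (sym (block≡ w≢ρ))
      (subst (_∈ applyUpTo (λ j → place (owner x) (suc j)) s) (sym e) (∈-applyUpTo⁺ (λ j → place (owner x) (suc j)) j<s))
    go (yes refl) (orig v) refl = subst (orig ρ ∈_) (sym block-ρ) (here refl)
    go (yes refl) (mid e i) q = ⊥-elim (owner-mid≢ρ e i q)

  block-unique : ∀ w → Unique (block w)
  block-unique w with w ≟ ρ
  ... | yes _ = [] ∷ []
  ... | no w≢ρ = AllPairs.applyUpTo⁺₁ (λ j → place w (suc j)) s λ {i} {j} i<j j<s e →
    <-irrefl (suc-injective (+-cancelˡ-≡ (dep (par w) * s) _ _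
      (≡.trans (sym (place-depth w≢ρ (<-trans i<j j<s))) (≡.trans (cong depth e) (place-depth w≢ρ j<s))))) i<j

  blocks : List (Fin n) → List (V T′)
  blocks vs = concat (map block vs)

  thread : Fin n → List (V T′)
  thread v = blocks (chain v)

  ∈-blocks⁻ : ∀ vs {x} → x ∈ blocks vs → owner x ∈ vs
  ∈-blocks⁻ vs {x} x∈ with ∈-concat⁻′ (map block vs) x∈
  ... | b , x∈b , b∈ with ∈-map⁻ block b∈
  ...   | w , w∈ , refl = subst (_∈ vs) (sym (block-owner w x∈b)) w∈

  thread-unique : ∀ v → Unique (thread v)
  thread-unique v = Unique.concat⁺ (All.map⁺ (All.universal block-unique (chain v)))
    (AllPairs.map⁺ (AllPairs.map apart (chain-unique v)))
    where
    apart : ∀ {u w} → u ≢ w → Disjoint (block u) (block w)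
    apart {u} {w} u≢w (p , q) = u≢w (≡.trans (sym (block-owner u p)) (block-owner w q))

  track-linked : ∀ {w} → w ≢ ρ → Linked (Adj T′) (applyUpTo (place w) (suc s))
  track-linked {w} w≢ρ = Linked.applyUpTo⁺₁ (place w) (suc s) λ i<s → place-adj w≢ρ (s≤s⁻¹ i<s)

  -- `orig (par v)` is prepended so that the induction hypothesis for a kid contains the vertex at
  -- which the two pieces are glued.
  Hangs : Fin n → Set
  Hangs v = v ≢ ρ → Linked (Adj T′) (orig (par v) ∷ thread v)

  thread-hangs : ∀ v → Hangs v
  thread-hangs = chain-induction Hangs base extend
    where
    base : ∀ v → Barren v → chain v ≡ [ v ] → Hangs v
    base v _ e v≢ρ = subst₂ (λ x xs → Linked (Adj T′) (x ∷ xs)) (place-top v≢ρ)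
      (≡.trans (sym (block≡ v≢ρ)) (≡.trans (sym (++-identityʳ (block v))) (cong blocks (sym e)))) (track-linked v≢ρ)
    extend : ∀ v w → Kid v w → chain v ≡ v ∷ chain w → Hangs w → Hangs v
    extend v w (w≢ρ , refl) e ih v≢ρ = subst (Linked (Adj T′)) eq
      (linked-glue (applyUpTo (place v) s)
        (subst (Linked (Adj T′)) (≡.trans (sym (applyUpTo-∷ʳ (place v) s)) (cong (λ x → applyUpTo (place v) s ++ [ x ]) (place-bottom v≢ρ)))
          (track-linked v≢ρ)) (ih w≢ρ))
      where
      eq : applyUpTo (place v) s ++ orig v ∷ thread w ≡ orig (par v) ∷ thread v
      eq = ≡.trans (sym (++-assoc (applyUpTo (place v) s) [ orig v ] (thread w)))
        (≡.trans (cong (_++ thread w) (≡.trans (cong (λ x → applyUpTo (place v) s ++ [ x ]) (sym (place-bottom v≢ρ))) (applyUpTo-∷ʳ (place v) s)))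
          (cong₂ _∷_ (place-top v≢ρ) (≡.trans (cong (_++ thread w) (sym (block≡ v≢ρ))) (cong blocks (sym e)))))

  thread-ρ : let w , _ = root-long in thread ρ ≡ orig ρ ∷ thread w
  thread-ρ = let w , _ , e , _ = root-long in ≡.trans (cong blocks e) (cong (_++ thread w) block-ρ)

  thread-linked : ∀ v → Linked (Adj T′) (thread v)
  thread-linked v with v ≟ ρ
  ... | no v≢ρ = Linked.tail (thread-hangs v v≢ρ)
  ... | yes refl = let w , (w≢ρ , p) , _ = root-long in
    subst (Linked (Adj T′)) (sym thread-ρ) (subst (λ u → Linked (Adj T′) (orig u ∷ thread w)) p (thread-hangs w w≢ρ))

  thread-length : ∀ v → v ≢ ρ → length (thread v) ≡ length (chain v) * s
  thread-length = chain-induction _ base extend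
    where
    block-length : ∀ {v} → v ≢ ρ → length (block v) ≡ s
    block-length {v} v≢ρ = ≡.trans (cong length (block≡ v≢ρ)) (length-applyUpTo (λ j → place v (suc j)) s)
    base : ∀ v → Barren v → chain v ≡ [ v ] → v ≢ ρ → length (thread v) ≡ length (chain v) * s
    base v _ e v≢ρ = ≡.trans (cong (λ c → length (blocks c)) e) (≡.trans (length-++ (block v))
      (≡.trans (cong (_+ 0) (block-length v≢ρ)) (cong (λ c → length c * s) (sym e))))
    extend : ∀ v w → Kid v w → chain v ≡ v ∷ chain w → (w ≢ ρ → length (thread w) ≡ length (chain w) * s) →
             v ≢ ρ → length (thread v) ≡ length (chain v) * s
    extend v w (w≢ρ , _) e ih v≢ρ = ≡.trans (cong (λ c → length (blocks c)) e) (≡.trans (length-++ (block v))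
      (≡.trans (cong₂ _+_ (block-length v≢ρ) (ih w≢ρ)) (cong (λ c → length c * s) (sym e))))

  Top : Fin n → Set
  Top v = ¬ Continues v

  thread-long : ∀ v → Top v → s * k ≤ 2 * length (thread v)
  thread-long v top with v ≟ ρ
  ... | no v≢ρ = subst (s * k ≤_) (sym (≡.trans (cong (2 *_) (thread-length v v≢ρ))
      (solve 2 (λ c s → con 2 :* (c :* s) := s :* (con 2 :* c)) refl (length (chain v)) s)))
      (*-monoʳ-≤ s (top-long v≢ρ top))
    where open +-*-Solver
  -- The thread of the kid alone has at least s * k vertices.
  ... | yes refl = let w , (w≢ρ , _) , _ , k≤ = root-long in
    ≤-trans (*-monoʳ-≤ s k≤) (≤-trans (≤-reflexive (≡.trans (*-comm s (length (chain w))) (sym (thread-length w w≢ρ))))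
      (≤-trans (n≤1+n _) (≤-trans (≤-reflexive (cong length (sym thread-ρ))) (m≤m+n _ _))))

  chain-continue : ∀ v u → Continues u → par u ∈ chain v → u ∈ chain v
  chain-continue = chain-induction _ base extend
    where
    base : ∀ v → Barren v → chain v ≡ [ v ] → ∀ u → Continues u → par u ∈ chain v → u ∈ chain v
    base v b e u (u≢ρ , _) p∈ with subst (par u ∈_) e p∈
    ... | here p≡v = ⊥-elim (b u (u≢ρ , p≡v))
    extend : ∀ v w → Kid v w → chain v ≡ v ∷ chain w → (∀ u → Continues u → par u ∈ chain w → u ∈ chain w) →
             ∀ u → Continues u → par u ∈ chain v → u ∈ chain v
    extend v w q e ih u c@(_ , ce) p∈ with subst (par u ∈_) e p∈
    ... | here refl = subst (u ∈_) (sym ce) (there (self∈chain u))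
    ... | there p∈w = subst (u ∈_) (sym e) (there (ih u c p∈w))

  continues? : ∀ v → Dec (Continues v)
  continues? v = ¬? (v ≟ ρ) ×-dec ≡-dec _≟_ (chain (par v)) (par v ∷ chain v)

  top? : ∀ v → Dec (Top v)
  top? v = ¬? (continues? v)

  top-of : ∀ g u → dep u ≤ g → ∃ λ v → Top v × u ∈ chain v
  top-of g u le with continues? u
  ... | no top = u , top , self∈chain u
  top-of zero u le | yes (u≢ρ , _) = ⊥-elim (<⇒≱ (subst (0 <_) (sym (par-dep u≢ρ)) (s≤s z≤n)) le)
  top-of (suc g) u le | yes c@(u≢ρ , _) =
    let v , top , p∈ = top-of g (par u) (s≤s⁻¹ (subst (_≤ suc g) (par-dep u≢ρ) le))
    in v , top , chain-continue v u c p∈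

  tops : List (Fin n)
  tops = filter top? (allFin n)

  -- The owner of a common vertex lies in both chains, so one top lies in the chain of the other.
  -- Not being its head, it would continue its parent.
  tops-disjoint : ∀ {v w} → Top v → v ≢ w × Top w → Disjoint (thread v) (thread w)
  tops-disjoint {v} {w} tv (v≢w , tw) (p , q) with comparable _ _ v w ≤-refl (∈-blocks⁻ (chain v) p) (∈-blocks⁻ (chain w) q)
  ... | inj₁ v∈ with ∈-chain w v v∈
  ...   | inj₁ e = v≢w e
  ...   | inj₂ (c , _) = tv c
  tops-disjoint {v} {w} tv (v≢w , tw) (p , q) | inj₂ w∈ with ∈-chain v w w∈
  ...   | inj₁ e = v≢w (sym e)
  ...   | inj₂ (c , _) = tw c

  threads-disjoint : ∀ {vs} → Unique vs → All Top vs → AllPairs Disjoint (map thread vs)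
  threads-disjoint [] [] = []
  threads-disjoint (v∉ ∷ u) (t ∷ ts) = All.map⁺ (All.zipWith (tops-disjoint t) (v∉ , ts)) ∷ threads-disjoint u ts

  decomposition : Decomposition T′ (s * k) 2
  decomposition = record
    { paths = map thread tops
    ; areLong = All.map⁺ (All.map (λ {v} top → record
        { linked = thread-linked v ; unique = thread-unique v ; noSquare = no-square (thread v) ; long = thread-long v top })
        (All.all-filter top? (allFin n)))
    ; disjoint = threads-disjoint (Unique.filter⁺ top? (Unique.allFin⁺ n)) (All.all-filter top? (allFin n))
    ; covers = λ x → let v , top , o∈ = top-of _ (owner x) ≤-refl in
        thread v , ∈-map⁺ thread (∈-filter⁺ top? (∈-allFin v) top) ,
        ∈-concat⁺′ (∈-block x) (∈-map⁺ block o∈) }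

theorem3p9 : (n m : ℕ) (ends : Fin m → Fin n × Fin n) →
    SimpleEdges ends → IsTree (EdgeGraph ends) →
    (k d : ℕ) → HasSpread (EdgeGraph ends) k → HasDiameter (EdgeGraph ends) d →
    (s : ℕ) → 1 ≤ s → 72 * d ^ 2 ≤ s * k ^ 3 →
    Stackable (cube (Subdivision ends s))
theorem3p9 n m ends simple isTree k d spread@((x , y , _ , _ , x≢y , walk , _) , _) diameter (suc s′) _ le =
  cube-stackable T′-metric T′-colouring T′-irrefl (s * d) (s * k) (*-mono-≤ {1} {s} (s≤s z≤n) 1≤d) T′-bounded volume decomposition
  where
  open Subdivided ends simple isTree k d spread diameter s′
  1≤d : 1 ≤ d
  1≤d = ≤-trans (nonempty walk) (proj₂ diameter x y k (proj₂ (proj₂ (proj₂ (proj₂ (proj₂ (proj₁ spread)))))))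
    where
    nonempty : ∀ {l} → Walk (EdgeGraph ends) x y l → 1 ≤ l
    nonempty here = ⊥-elim (x≢y refl)
    nonempty (step _ _) = s≤s z≤n
  open +-*-Solver
  -- The hypothesis multiplied by s², regrouped into powers of s * d and s * k.
  volume : 72 * (s * d * (s * d)) ≤ s * k * (s * k * (s * k))
  volume = ≤-trans
    (≤-reflexive (solve 2 (λ s d → con 72 :* (s :* d :* (s :* d)) := s :* s :* (con 72 :* (d :* (d :* con 1)))) refl s d))
    (≤-trans (*-monoʳ-≤ (s * s) le)
      (≤-reflexive (solve 2 (λ s k → s :* s :* (s :* (k :* (k :* (k :* con 1)))) := s :* k :* (s :* k :* (s :* k))) refl s k)))
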